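{- The following two assertions are equivalent. (A) For all integers $r\ge 2$ and $t\ge 1$, every tight $r$-tree $T$ with $t$ edges, and every $r$-graph $G$ that does not contain $T$, one has $e(G)\le\frac{t-1}{r}|\partial(G)|$. (B) For all integers $r\ge 2$ and $t\ge 2$, every tight $r$-tree $T$ with $t$ edges, and every integer $n\ge r$, one has $\mathrm{ex}_r(n,T)\le\frac{t-1}{r}\binom{n}{r-1}$.
   Context: An $r$-graph is a (finite) $r$-uniform hypergraph; $e(G)$ is the number of edges of $G$. The shadow of an $r$-graph $G$ is $\partial(G)=\{S: |S|=r-1,\ S\subseteq e\text{ for some }e\in E(G)\}$. An $r$-graph $T$ is a tight $r$-tree if its edges can be ordered as $e_1,\dots,e_t$ so that for each $i\ge 2$ there are a vertex $v\in e_i$ and an index $1\le s\le i-1$ such that $v\notin\bigcup_{j=1}^{i-1}e_j$ and $e_i\setminus\{v\}\subset e_s$. The vertex set of a tight tree is the union of its edges. An $r$-graph $G$ contains $T$ if there is an injection $V(T)\to V(G)$ mapping every edge of $T$ to an edge of $G$. $\mathrm{ex}_r(n,T)$ is the largest $m$ such that there exists an $n$-vertex $r$-graph with $m$ edges that does not contain $T$, for $n\ge r$. Assertion (B) is Kalai's conjecture and (A) is its shadow version; both are open, and the claim is only that they are equivalent. -}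

module Defs where

open import Data.Bool using (if_then_else_)
open import Data.Bool.Properties using () renaming (_≟_ to _≟ᵇ_)
open import Data.Fin using (Fin; zero; suc; toℕ)
open import Data.Fin.Properties using (any?; all?; injective⇒≤) renaming (_≟_ to _≟ᶠ_)
open import Data.Fin.Subset using (Subset; inside; outside; ⊤; ⋃; _∈_; _∉_; _⊆_; _-_; ∣_∣)
open import Data.Fin.Subset.Properties using (_∈?_; _⊆?_; anySubset?)
open import Data.List using (List; []; _∷_; _++_; map; filter; length; lookup; take)
open import Data.List.Properties using (length-map; length-++)
open import Data.List.Membership.Propositional using () renaming (_∈_ to _∈ₗ_)
open import Data.List.Membership.Propositional.Properties using (∈-map⁺; ∈-++⁺ˡ; ∈-++⁺ʳ; ∈-lookup)
open import Data.List.Relation.Binary.Permutation.Propositional using (_↭_)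
open import Data.List.Relation.Unary.All as All using (All; []; _∷_)
open import Data.List.Relation.Unary.AllPairs using ([]; _∷_; allPairs?)
open import Data.List.Relation.Unary.Any as Any using (here; index)
open import Data.List.Relation.Unary.Any.Properties using (lookup-index)
open import Data.List.Relation.Unary.Unique.Propositional using (Unique)
open import Data.Nat using (ℕ; zero; suc; _+_; _∸_; _^_; _≤_; _<_; s≤s; _≟_)
open import Data.Nat.Properties using (m≤n⇒m<n∨m≡n; +-identityʳ)
open import Data.Product using (Σ; ∃; ∃-syntax; _×_; _,_)
open import Data.Sum using (inj₁; inj₂)
open import Data.Vec using ([]; _∷_; tabulate)
open import Data.Vec.Properties using (≡-dec; tabulate-cong)
open import Function using (_∘_)
open import Function.Bundles using (mk⇔)
open import Function.Definitions using (Injective)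
open import Relation.Binary.PropositionalEquality
open import Relation.Nullary using (Dec; yes; no; does; ¬_; ¬?; contradiction)
open import Relation.Nullary.Decidable using (map′; _×-dec_; _→-dec_; does-⇔)
open import Relation.Unary using (Decidable)

private
  variable
    r k n m : ℕ

-- An r-graph with vertex set Fin n. The edge set is a duplicate-free list; its
-- order carries no meaning.
record RGraph (r n : ℕ) : Set where
  field
    edges    : List (Subset n)
    uniform  : All (λ p → ∣ p ∣ ≡ r) edges
    distinct : Unique edges

open RGraph public

e : RGraph r n → ℕ
e G = length (edges G)

allSubsets : ∀ n → List (Subset n)
allSubsets zero    = [] ∷ []
allSubsets (suc n) = map (inside ∷_) (allSubsets n) ++ map (outside ∷_) (allSubsets n)

∂ : RGraph r n → List (Subset n)
∂ {r} {n} G =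
  filter (λ p → (∣ p ∣ ≟ r ∸ 1) ×-dec Any.any? (p ⊆?_) (edges G)) (allSubsets n)

-- Positions count from 0, so 1 ≤ toℕ i excludes exactly the first edge.
TightOrder : List (Subset n) → Set
TightOrder {n} es =
  ∀ (i : Fin (length es)) → 1 ≤ toℕ i →
  Σ (Fin n) λ v → Σ (Fin (length es)) λ s →
    v ∈ lookup es i ×
    toℕ s < toℕ i ×
    v ∉ ⋃ (take (toℕ i) es) ×
    (lookup es i - v) ⊆ lookup es s

-- The field spanning says that V(T) = Fin k is the union of the edges.
record IsTightTree (T : RGraph r k) : Set where
  field
    spanning : ⋃ (edges T) ≡ ⊤
    ordering : ∃[ es ] (es ↭ edges T × TightOrder es)

hit? : (f : Fin k → Fin n) (p : Subset k) (y : Fin n) → Dec (∃[ x ] (x ∈ p × f x ≡ y))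
hit? f p y = any? (λ x → (x ∈? p) ×-dec (f x ≟ᶠ y))

image : (Fin k → Fin n) → Subset k → Subset n
image f p = tabulate (λ y → does (hit? f p y))

Contains : RGraph r n → RGraph r k → Set
Contains {n = n} {k = k} G T =
  Σ (Fin k → Fin n) λ f →
    Injective _≡_ _≡_ f × All (λ p → image f p ∈ₗ edges G) (edges T)

Avoidable : ∀ n → RGraph r k → ℕ → Set
Avoidable {r} n T m = Σ (RGraph r n) λ G → e G ≡ m × ¬ Contains G T

IsLargest : (ℕ → Set) → ℕ → Set
IsLargest P m = P m × (∀ m′ → P m′ → m′ ≤ m)

private
  _≟ˢ_ : (p q : Subset n) → Dec (p ≡ q)
  _≟ˢ_ = ≡-dec _≟ᵇ_

  anyList? : ∀ m {P : List (Subset n) → Set} → Decidable P →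
             Dec (∃[ xs ] (length xs ≡ m × P xs))
  anyList? zero P? =
    map′ (λ p → [] , refl , p) (λ { ([] , _ , p) → p }) (P? [])
  anyList? (suc m) P? =
    map′ (λ { (x , xs , l , p) → x ∷ xs , cong suc l , p })
         (λ { (x ∷ xs , refl , p) → x , xs , refl , p })
         (anySubset? (λ x → anyList? m (λ xs → P? (x ∷ xs))))

  cons : Fin n → (Fin k → Fin n) → Fin (suc k) → Fin n
  cons x f zero    = x
  cons x f (suc i) = f i

  anyFun? : ∀ k {P : (Fin k → Fin n) → Set} → (∀ f g → f ≗ g → P f → P g) →
            Decidable P → Dec (∃ P)
  anyFun? zero resp P? =
    map′ (λ p → none , p) (λ { (f , p) → resp f none (λ ()) p }) (P? none)
    where
    none : Fin 0 → Fin _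
    none ()
  anyFun? (suc k) resp P? =
    map′ (λ { (x , f , p) → cons x f , p })
         (λ { (f , p) → f zero , f ∘ suc , resp f _ (λ { zero → refl ; (suc i) → refl }) p })
         (any? (λ x → anyFun? k (λ f g f≗g → resp (cons x f) (cons x g) (λ { zero → refl ; (suc i) → f≗g i }))
                                (λ f → P? (cons x f))))

  image-cong : ∀ {f g : Fin k → Fin n} → f ≗ g → image f ≗ image g
  image-cong {f = f} {g} f≗g p = tabulate-cong λ y →
    does-⇔ (mk⇔
      (λ { (x , x∈p , fx) → x , x∈p , trans (sym (f≗g x)) fx })
      (λ { (x , x∈p , gx) → x , x∈p , trans (f≗g x) gx }))
      (hit? f p y) (hit? g p y)

  injective? : (f : Fin k → Fin n) → Dec (Injective _≡_ _≡_ f)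
  injective? f =
    map′ (λ h {x} {y} → h x y) (λ h x y → h)
         (all? λ x → all? λ y → (f x ≟ᶠ f y) →-dec (x ≟ᶠ y))

contains? : (G : RGraph r n) (T : RGraph r k) → Dec (Contains G T)
contains? {k = k} G T =
  anyFun? k
    (λ f g f≗g (inj , im) →
      (λ {x} {y} eq → inj (trans (f≗g x) (trans eq (sym (f≗g y))))) ,
      All.map (λ {p} → subst (_∈ₗ edges G) (image-cong f≗g p)) im)
    (λ f → injective? f ×-dec All.all? (λ p → Any.any? (image f p ≟ˢ_) (edges G)) (edges T))

avoidable? : ∀ n (T : RGraph r k) → Decidable (Avoidable n T)
avoidable? {r} n T m =
  map′ (λ { (xs , l , u , d , c) → record { edges = xs ; uniform = u ; distinct = d } , l , c })
       (λ { (G , l , c) → edges G , l , uniform G , distinct G , c })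
       (anyList? m P?)
  where
  P : List (Subset n) → Set
  P xs = Σ (All (λ p → ∣ p ∣ ≡ r) xs) λ u → Σ (Unique xs) λ d →
         ¬ Contains (record { edges = xs ; uniform = u ; distinct = d }) T

  P? : Decidable P
  P? xs with All.all? (λ p → ∣ p ∣ ≟ r) xs | allPairs? (λ p q → ¬? (p ≟ˢ q)) xs
  ... | no ¬u | _     = no (λ { (u , _) → ¬u u })
  ... | yes _ | no ¬d = no (λ { (_ , d , _) → ¬d d })
  ... | yes u | yes d =
    map′ (λ c → u , d , c) (λ { (_ , _ , c) → c })
         (¬? (contains? (record { edges = xs ; uniform = u ; distinct = d }) T))

-- The largest m ≤ b satisfying P, or 0 if there is none.
greatest : {P : ℕ → Set} → Decidable P → ℕ → ℕ
greatest P? zero    = zero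
greatest P? (suc b) = if does (P? (suc b)) then suc b else greatest P? b

-- An r-graph on n vertices has at most 2 ^ n edges, so the search is
-- exhaustive; see ex-largest.
ex : ∀ n → RGraph r k → ℕ
ex n T = greatest (avoidable? n T) (2 ^ n)

private
  greatest-largest : {P : ℕ → Set} (P? : Decidable P) → P 0 → ∀ b →
                     (∀ m → P m → m ≤ b) → IsLargest P (greatest P? b)
  greatest-largest P? p₀ zero bound = p₀ , bound
  greatest-largest P? p₀ (suc b) bound with P? (suc b)
  ... | yes p = p , bound
  ... | no ¬p = greatest-largest P? p₀ b λ m p → below m p (m≤n⇒m<n∨m≡n (bound m p))
    where
    below : ∀ m → _ → _ → m ≤ b
    below m p (inj₁ (s≤s m≤b)) = m≤b
    below m p (inj₂ refl)      = contradiction p ¬p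

∈-allSubsets : (p : Subset n) → p ∈ₗ allSubsets n
∈-allSubsets []            = here refl
∈-allSubsets (inside  ∷ p) = ∈-++⁺ˡ (∈-map⁺ (inside ∷_) (∈-allSubsets p))
∈-allSubsets (outside ∷ p) =
  ∈-++⁺ʳ (map (inside ∷_) (allSubsets _)) (∈-map⁺ (outside ∷_) (∈-allSubsets p))

length-allSubsets : ∀ n → length (allSubsets n) ≡ 2 ^ n
length-allSubsets zero    = refl
length-allSubsets (suc n) =
  trans (length-++ (map (inside ∷_) (allSubsets n)))
    (cong₂ _+_ (trans (length-map (inside ∷_) (allSubsets n)) ih)
               (trans (length-map (outside ∷_) (allSubsets n))
                      (trans ih (sym (+-identityʳ (2 ^ n))))))
  where ih = length-allSubsets n

private
  lookup-inj : {xs : List (Subset n)} → Unique xs → Injective _≡_ _≡_ (lookup xs)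
  lookup-inj (_ ∷ _) {zero}  {zero}  _  = refl
  lookup-inj (a ∷ _) {zero}  {suc j} eq = contradiction eq (All.lookup a (∈-lookup j))
  lookup-inj (a ∷ _) {suc i} {zero}  eq = contradiction (sym eq) (All.lookup a (∈-lookup i))
  lookup-inj (_ ∷ u) {suc i} {suc j} eq = cong suc (lookup-inj u eq)

e≤2^n : (G : RGraph r n) → e G ≤ 2 ^ n
e≤2^n {n = n} G = subst (e G ≤_) (length-allSubsets n) (injective⇒≤ {f = pos} pos-inj)
  where
  pos : Fin (e G) → Fin (length (allSubsets n))
  pos i = index (∈-allSubsets (lookup (edges G) i))

  pos-inj : Injective _≡_ _≡_ pos
  pos-inj {i} {j} eq = lookup-inj (distinct G)
    (trans (lookup-index (∈-allSubsets (lookup (edges G) i)))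
      (trans (cong (lookup (allSubsets n)) eq)
        (sym (lookup-index (∈-allSubsets (lookup (edges G) j))))))

ex-largest : ∀ n (T : RGraph r k) → 1 ≤ e T → IsLargest (Avoidable n T) (ex n T)
ex-largest {r} n T 1≤e =
  greatest-largest (avoidable? n T) (empty , refl , free (edges T) 1≤e) (2 ^ n)
    (λ { _ (G , refl , _) → e≤2^n G })
  where
  empty : RGraph r n
  empty = record { edges = [] ; uniform = [] ; distinct = [] }

  free : ∀ es → 1 ≤ length es →
         ¬ (Σ _ λ f → Injective _≡_ _≡_ f × All (λ p → image f p ∈ₗ edges empty) es)
  free (_ ∷ _) _ (_ , _ , () ∷ _)

{-# OPTIONS --safe #-}

-- Let G avoid the tight tree T with r e(G) > (t − 1)|∂G|, and put s = r − 1. Copies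
-- of G with pairwise disjoint shadows form a T-free r-graph, so (B) bounds their
-- number, and it suffices to pack copies of ∂G almost perfectly into the complete
-- s-graph. Take a complete n-partite s-graph with n large and fixed and parts of size
-- c; by (B) every packing leaves a constant fraction of its s-sets uncovered, in
-- particular of those lying over some s-set of parts. Blow every vertex up by
-- q = (nc)! + 1. The polynomials of degree < s over ℤ/q decompose the transversal
-- s-sets of the blow-up into copies of the old s-graph; put a randomly moved copy of
-- the old packing on each of them. The monic polynomials of degree s give a second
-- decomposition which meets the first in at most s points at a time. Hence the s-sets
-- of one copy of ∂G on a monic polynomial are uncovered independently, and a constant
-- fraction of these copies can be added to the packing. The density of the packing
-- grows by a fixed amount at each step, which cannot go on forever.

module Submission where

open import Defs
open import Data.Empty using (⊥; ⊥-elim)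
open import Data.Fin using (Fin; zero; suc; toℕ; fromℕ<; combine; remQuot; finToFun; funToFin; _↑ˡ_; _↑ʳ_; inject≤)
open import Data.Fin.Properties using (any?; all?; 0≢1+n; suc-injective; toℕ-injective; toℕ-fromℕ<; toℕ<n;
  combine-injective; combine-remQuot; remQuot-combine; finToFun-funToFin; funToFin-finToFin; inject≤-injective)
  renaming (_≟_ to _≟ᶠ_)
open import Data.Product using (Σ; ∃-syntax; _×_; _,_; proj₁; proj₂; uncurry)
open import Function using (_∘_; id)
open import Function.Bundles using (_⇔_; mk⇔)
open import Function.Definitions using (Injective)
open import Relation.Binary.PropositionalEquality
open import Relation.Nullary

-- (B) knows a graph only through its number of vertices, so a bound by |∂G| has to come from
-- filling almost all s-sets with copies of ∂G. No packing theorem is invoked for this. All that is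
-- proved is that a packing with a constant fraction uncovered can be improved by an amount
-- independent of c. The obstacle is that the uncovered s-sets may be concentrated over a single
-- s-set T of parts, whereas the E = |∂G| shadow sets of a new copy lie over E different ones. Hence
-- the moves include permutations of the parts, one for each shadow set, carrying T to the parts of
-- that set. The relevant permutation is drawn with probability 1/E, and a random reflection inside
-- each part then makes the transversal to be avoided uniform. If at least 1/K of the transversals
-- over T are uncovered, each shadow set is safe with probability at least 1/(E K), and the whole
-- copy with probability at least (E K)^(-E). Neither bound involves c. Probabilities appear in the
-- code as counts with the denominators cleared.

module Residues where

  open import Data.Integer as ℤ using (ℤ; +_; _-_; -_) renaming (_+_ to _+ᶻ_; _*_ to _*ᶻ_)
  import Data.Integer.Properties as ℤₚ
  open import Data.Integer.Divisibility.Signed as ∣ᶻ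
    using (divides; ∣m∣n⇒∣m-n; ∣m⇒∣m*n; ∣n⇒∣m*n; ∣m+n∣n⇒∣m; ∣⇒∣ᵤ) renaming (_∣_ to _∣ᶻ_)
  open import Data.Integer.DivMod using (_%ℕ_; n%ℕd<d; a≡a%ℕn+[a/ℕn]*n; _/ℕ_)
  open import Data.Integer.Tactic.RingSolver using (solve-∀)
  open import Data.Nat as ℕ using (ℕ; zero; suc; _≤_; _<_; NonZero; _!; s≤s; z≤n)
  import Data.Nat.Properties as ℕₚ
  import Data.Nat.Divisibility as ℕ∣
  open import Data.Vec using (Vec; []; _∷_; _∷ʳ_; tabulate; zipWith)
  open import Data.Vec.Properties using (lookup∘tabulate; lookup-zipWith)
  open import Data.Vec.Relation.Unary.All using (All; []; _∷_)
  import Data.Vec.Relation.Unary.All.Properties as VAll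

  private variable
    d c B : ℕ

  -- Residue classes and their reflections

  residue : ∀ c .{{_ : NonZero c}} → ℤ → Fin c
  residue c a = fromℕ< (n%ℕd<d a c)

  residue-≡ : ∀ c .{{_ : NonZero c}} a → + c ∣ᶻ a - + toℕ (residue c a)
  residue-≡ c a = divides (a /ℕ c) (begin
    a - + toℕ (residue c a)                          ≡⟨ cong (λ z → a - + z) (toℕ-fromℕ< (n%ℕd<d a c)) ⟩
    a - + (a %ℕ c)                                   ≡⟨ cong (_- + (a %ℕ c)) (a≡a%ℕn+[a/ℕn]*n a c) ⟩
    + (a %ℕ c) +ᶻ a /ℕ c *ᶻ + c - + (a %ℕ c)         ≡⟨ cancel (+ (a %ℕ c)) (a /ℕ c *ᶻ + c) ⟩
    a /ℕ c *ᶻ + c ∎)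
    where
    open ≡-Reasoning
    cancel : ∀ x y → x +ᶻ y - x ≡ y
    cancel = solve-∀

  small-multiple : ∀ {x y} → x < c → y < c → + c ∣ᶻ + x - + y → x ≡ y
  small-multiple {c} {x} {y} x<c y<c dvd = ℤₚ.+-injective (ℤₚ.i-j≡0⇒i≡j (+ x) (+ y)
      (trans (ℤₚ.m-n≡m⊖n x y) (ℤₚ.∣i∣≡0⇒i≡0 (∣∧<⇒≡0 (subst (c ℕ∣.∣_) (cong ℤ.∣_∣ (ℤₚ.m-n≡m⊖n x y)) (∣⇒∣ᵤ dvd))
        (ℕₚ.≤-<-trans (ℤₚ.∣m⊝n∣≤m⊔n x y) (ℕₚ.⊔-lub x<c y<c))))))
    where
    ∣∧<⇒≡0 : ∀ {z} → c ℕ∣.∣ z → z < c → z ≡ 0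
    ∣∧<⇒≡0 {zero}  _  _   = refl
    ∣∧<⇒≡0 {suc z} dv z<c = contradiction (ℕ∣.∣⇒≤ dv) (ℕₚ.<⇒≱ z<c)

  toℕ-∣-injective : (i j : Fin c) → + c ∣ᶻ + toℕ i - + toℕ j → i ≡ j
  toℕ-∣-injective i j dvd = toℕ-injective (small-multiple (toℕ<n i) (toℕ<n j) dvd)

  residue-unique : ∀ c .{{_ : NonZero c}} a (i : Fin c) → + c ∣ᶻ a - + toℕ i → residue c a ≡ i
  residue-unique c a i dvd = toℕ-∣-injective _ i (subst (+ c ∣ᶻ_) (shift a (+ toℕ i) (+ toℕ (residue c a)))
      (∣m∣n⇒∣m-n dvd (residue-≡ c a)))
    where
    shift : ∀ a x y → (a - x) - (a - y) ≡ y - x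
    shift = solve-∀

  residue-injective : ∀ c .{{_ : NonZero c}} a b → residue c a ≡ residue c b → + c ∣ᶻ a - b
  residue-injective c a b eq = subst (+ c ∣ᶻ_) (shift a b (+ toℕ (residue c a)))
      (∣m∣n⇒∣m-n (residue-≡ c a) (subst (λ i → + c ∣ᶻ b - + toℕ i) (sym eq) (residue-≡ c b)))
    where
    shift : ∀ a b x → (a - x) - (b - x) ≡ a - b
    shift = solve-∀

  -- x + y + reflect x y ≡ 0 (mod c), so any two of the three determine the third.
  reflect : Fin c → Fin c → Fin c
  reflect {suc c} x y = residue (suc c) (- (+ toℕ x) - + toℕ y)

  reflect-comm : (x y : Fin c) → reflect x y ≡ reflect y x
  reflect-comm {suc c} x y = cong (residue (suc c)) (swap (+ toℕ x) (+ toℕ y))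
    where
    swap : ∀ x y → - x - y ≡ - y - x
    swap = solve-∀

  reflect-involutive : (x y : Fin c) → reflect x (reflect x y) ≡ y
  reflect-involutive {suc c} x y = residue-unique (suc c) (- (+ toℕ x) - + toℕ (reflect x y)) y
    (subst (+ suc c ∣ᶻ_) (shift (+ toℕ x) (+ toℕ y) (+ toℕ (reflect x y)))
      (residue-≡ (suc c) (- (+ toℕ x) - + toℕ y)))
    where
    shift : ∀ x y z → - x - y - z ≡ - x - z - y
    shift = solve-∀

  -- Polynomial interpolation modulo B! + 1

  eval : Vec ℤ d → ℤ → ℤ
  eval []      x = + 0
  eval (a ∷ p) x = a +ᶻ x *ᶻ eval p x

  -- Synthetic division by X - y: the coefficients of the quotient are the values at y of the
  -- successive tails of the polynomial.
  quotientBy : ℤ → Vec ℤ (suc d) → Vec ℤ d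
  quotientBy {zero}  y _       = []
  quotientBy {suc d} y (a ∷ p) = eval p y ∷ quotientBy y p

  eval-quotientBy : ∀ (p : Vec ℤ (suc d)) x y →
                    eval p x - eval p y ≡ (x - y) *ᶻ eval (quotientBy y p) x
  eval-quotientBy {zero} (a ∷ []) x y = base a x y
    where
    base : ∀ a x y → (a +ᶻ x *ᶻ + 0) - (a +ᶻ y *ᶻ + 0) ≡ (x - y) *ᶻ + 0
    base = solve-∀
  eval-quotientBy {suc d} (a ∷ p) x y = begin
    (a +ᶻ x *ᶻ eval p x) - (a +ᶻ y *ᶻ eval p y)
      ≡⟨ step a x y (eval p x) (eval p y) ⟩
    (x - y) *ᶻ eval p y +ᶻ x *ᶻ (eval p x - eval p y)
      ≡⟨ cong (λ z → (x - y) *ᶻ eval p y +ᶻ x *ᶻ z) (eval-quotientBy p x y) ⟩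
    (x - y) *ᶻ eval p y +ᶻ x *ᶻ ((x - y) *ᶻ eval (quotientBy y p) x)
      ≡⟨ step′ x y (eval p y) (eval (quotientBy y p) x) ⟩
    (x - y) *ᶻ (eval p y +ᶻ x *ᶻ eval (quotientBy y p) x) ∎
    where
    open ≡-Reasoning
    step : ∀ a x y u v → (a +ᶻ x *ᶻ u) - (a +ᶻ y *ᶻ v) ≡ (x - y) *ᶻ v +ᶻ x *ᶻ (u - v)
    step = solve-∀
    step′ : ∀ x y u v → (x - y) *ᶻ u +ᶻ x *ᶻ ((x - y) *ᶻ v) ≡ (x - y) *ᶻ (u +ᶻ x *ᶻ v)
    step′ = solve-∀

  quotientBy-∣ : ∀ {m y} (p : Vec ℤ (suc d)) → m ∣ᶻ eval p y → All (m ∣ᶻ_) (quotientBy y p) → All (m ∣ᶻ_) p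
  quotientBy-∣ {zero}  {m} {y} (a ∷ []) dv [] = subst (m ∣ᶻ_) (base a y) dv ∷ []
    where
    base : ∀ a y → a +ᶻ y *ᶻ + 0 ≡ a
    base = solve-∀
  quotientBy-∣ {suc d} {y = y} (a ∷ p) dv (dv₀ ∷ dvs) =
    ∣m+n∣n⇒∣m dv (∣n⇒∣m*n y dv₀) ∷ quotientBy-∣ p dv₀ dvs

  -- Split off the root `x zero`. At every other root the factor x i - x zero can be cancelled by
  -- hypothesis, so the quotient vanishes there and induction applies. Cancellation takes the place
  -- of a field, since the modulus may be composite.
  vanishing : ∀ {m} (p : Vec ℤ d) (x : Fin d → ℤ) →
              (∀ i j z → i ≢ j → m ∣ᶻ (x i - x j) *ᶻ z → m ∣ᶻ z) →
              (∀ i → m ∣ᶻ eval p (x i)) → All (m ∣ᶻ_) p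
  vanishing {zero}  []  x unit root = []
  vanishing {suc d} {m} p x unit root = quotientBy-∣ p (root zero)
    (vanishing (quotientBy (x zero) p) (x ∘ suc) (λ i j z i≢j → unit (suc i) (suc j) z (i≢j ∘ suc-injective))
      (λ i → unit (suc i) zero _ (λ ()) (subst (m ∣ᶻ_) (eval-quotientBy p (x (suc i)) (x zero))
        (∣m∣n⇒∣m-n (root (suc i)) (root zero)))))

  modulus : ℕ → ℕ
  modulus B = suc (B !)

  k∣B! : ∀ {k} → 1 ≤ k → k ≤ B → k ℕ∣.∣ B !
  k∣B! {k = suc k} _ le = ℕ∣.∣-trans (ℕ∣.m∣m*n (k !)) (ℕ∣.m≤n⇒m!∣n! le)

  -- Points 0, …, B − 1 differ by divisors of B! ≡ −1, hence by units.
  difference-unit : ∀ {x y} → x < B → y < B → x ≢ y → ∀ z →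
                    + modulus B ∣ᶻ (+ x - + y) *ᶻ z → + modulus B ∣ᶻ z
  difference-unit {B} {x} {y} x<B y<B x≢y z dv with divisor
    where
    divisor : (+ x - + y) ∣ᶻ + (B !)
    divisor = ∣ᶻ.∣ᵤ⇒∣ (subst (ℕ∣._∣ B !) (cong ℤ.∣_∣ (sym (ℤₚ.m-n≡m⊖n x y)))
      (k∣B! (ℕₚ.n≢0⇒n>0 (x≢y ∘ λ eq → ℤₚ.+-injective (ℤₚ.i-j≡0⇒i≡j (+ x) (+ y)
                (trans (ℤₚ.m-n≡m⊖n x y) (ℤₚ.∣i∣≡0⇒i≡0 eq)))))
            (ℕₚ.≤-trans (ℤₚ.∣m⊝n∣≤m⊔n x y) (ℕₚ.⊔-lub (ℕₚ.<⇒≤ x<B) (ℕₚ.<⇒≤ y<B)))))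
  ... | divides k eq = subst (+ modulus B ∣ᶻ_) (collect (+ (B !)) z)
      (∣m∣n⇒∣m-n (∣m⇒∣m*n z ∣ᶻ.∣-refl)
        (subst (+ modulus B ∣ᶻ_) (trans (assoc k (+ x - + y) z) (cong (_*ᶻ z) (sym eq))) (∣n⇒∣m*n k dv)))
    where
    collect : ∀ f z → (+ 1 +ᶻ f) *ᶻ z - f *ᶻ z ≡ z
    collect = solve-∀
    assoc : ∀ k d z → k *ᶻ (d *ᶻ z) ≡ (k *ᶻ d) *ᶻ z
    assoc = solve-∀

  module Polynomial (s B : ℕ) where

    q : ℕ
    q = modulus B

    coefficients : (Fin s → Fin q) → Vec ℤ s
    coefficients f = tabulate (λ i → + toℕ (f i))

    poly : (Fin s → Fin q) → Fin B → Fin q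
    poly f x = residue q (eval (coefficients f) (+ toℕ x))

    monic : (Fin s → Fin q) → Vec ℤ (suc s)
    monic f = coefficients f ∷ʳ + 1

    poly⁺ : (Fin s → Fin q) → Fin B → Fin q
    poly⁺ f x = residue q (eval (monic f) (+ toℕ x))

    private
      roots : (p : Vec ℤ d) (x : Fin d → Fin B) → Injective _≡_ _≡_ x →
              (∀ i → + q ∣ᶻ eval p (+ toℕ (x i))) → All (+ q ∣ᶻ_) p
      roots p x inj = vanishing p (λ i → + toℕ (x i))
        (λ i j z i≢j → difference-unit (toℕ<n (x i)) (toℕ<n (x j)) (i≢j ∘ inj ∘ toℕ-injective) z)

      _⊟_ : Vec ℤ d → Vec ℤ d → Vec ℤ d
      _⊟_ = zipWith _-_

      eval-⊟ : ∀ (p r : Vec ℤ d) x → eval (p ⊟ r) x ≡ eval p x - eval r x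
      eval-⊟ []      []      x = refl
      eval-⊟ (a ∷ p) (b ∷ r) x = trans (cong (λ z → (a - b) +ᶻ x *ᶻ z) (eval-⊟ p r x))
                                       (step a b x (eval p x) (eval r x))
        where
        step : ∀ a b x u v → (a - b) +ᶻ x *ᶻ (u - v) ≡ (a +ᶻ x *ᶻ u) - (b +ᶻ x *ᶻ v)
        step = solve-∀

      eval-∷ʳ0 : ∀ (p : Vec ℤ d) x → eval (p ∷ʳ + 0) x ≡ eval p x
      eval-∷ʳ0 []      x = base x
        where
        base : ∀ x → + 0 +ᶻ x *ᶻ + 0 ≡ + 0
        base = solve-∀
      eval-∷ʳ0 (a ∷ p) x = cong (λ z → a +ᶻ x *ᶻ z) (eval-∷ʳ0 p x)

      agree-∣ : ∀ (p r : Vec ℤ d) x → residue q (eval p x) ≡ residue q (eval r x) → + q ∣ᶻ eval (p ⊟ r) x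
      agree-∣ p r x eq = subst (+ q ∣ᶻ_) (sym (eval-⊟ p r x)) (residue-injective q (eval p x) (eval r x) eq)

      monic-⊟ : ∀ (p r : Vec ℤ d) {a b : ℤ} → (p ∷ʳ a) ⊟ (r ∷ʳ b) ≡ (p ⊟ r) ∷ʳ (a - b)
      monic-⊟ []      []      = refl
      monic-⊟ (x ∷ p) (y ∷ r) = cong (x - y ∷_) (monic-⊟ p r)

      coefficients-unique : ∀ f g → All (+ q ∣ᶻ_) (coefficients f ⊟ coefficients g) → ∀ i → f i ≡ g i
      coefficients-unique f g all i = toℕ-∣-injective (f i) (g i)
        (subst (+ q ∣ᶻ_)
          (trans (lookup-zipWith _-_ i (coefficients f) (coefficients g))
                 (cong₂ _-_ (lookup∘tabulate _ i) (lookup∘tabulate _ i)))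
          (VAll.lookup⁺ all i))

    poly-unique : ∀ f g (x : Fin s → Fin B) → Injective _≡_ _≡_ x →
                  (∀ i → poly f (x i) ≡ poly g (x i)) → ∀ i → f i ≡ g i
    poly-unique f g x inj eq = coefficients-unique f g
      (roots _ x inj (λ i → agree-∣ (coefficients f) (coefficients g) _ (eq i)))

    -- The leading ones cancel in the difference, which is therefore again a polynomial with s
    -- coefficients and s roots.
    poly⁺-unique : ∀ f g (x : Fin s → Fin B) → Injective _≡_ _≡_ x →
                   (∀ i → poly⁺ f (x i) ≡ poly⁺ g (x i)) → ∀ i → f i ≡ g i
    poly⁺-unique f g x inj eq = coefficients-unique f g
      (roots _ x inj (λ i → subst (+ q ∣ᶻ_)
        (trans (cong (λ p → eval p (+ toℕ (x i))) (monic-⊟ (coefficients f) (coefficients g)))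
               (eval-∷ʳ0 (coefficients f ⊟ coefficients g) _))
        (agree-∣ (monic f) (monic g) _ (eq i))))

    -- The difference has degree s and leading coefficient 1. With s + 1 roots all its coefficients
    -- would be divisible by `q`, the leading one included.
    poly-poly⁺ : ∀ f g (x : Fin (suc s) → Fin B) → Injective _≡_ _≡_ x →
                 ¬ (∀ i → poly f (x i) ≡ poly⁺ g (x i))
    poly-poly⁺ f g x inj eq = contradiction (leading (coefficients g ⊟ coefficients f) dvd) q∤1
      where
      dvd : All (+ q ∣ᶻ_) ((coefficients g ⊟ coefficients f) ∷ʳ + 1)
      dvd = subst (All (+ q ∣ᶻ_)) (monic-⊟ (coefficients g) (coefficients f))
        (roots _ x inj (λ i → agree-∣ (monic g) (coefficients f ∷ʳ + 0) _
          (trans (sym (eq i)) (cong (residue q) (sym (eval-∷ʳ0 (coefficients f) _))))))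
      leading : ∀ {d} (p : Vec ℤ d) {a m} → All (m ∣ᶻ_) (p ∷ʳ a) → m ∣ᶻ a
      leading []      (dv ∷ []) = dv
      leading (_ ∷ p) (_ ∷ dvs) = leading p dvs
      q∤1 : ¬ + q ∣ᶻ + 1
      q∤1 dv = contradiction (ℕ∣.∣⇒≤ (∣⇒∣ᵤ dv)) (ℕₚ.<⇒≱ (s≤s (ℕₚ.1≤n! B)))

open Residues using (reflect; reflect-comm; reflect-involutive; modulus; module Polynomial)

open import Data.Bool using (if_then_else_)
open import Data.Bool.Properties using () renaming (_≟_ to _≟ᵇ_)
open import Data.Fin.Permutation using (permutation)
open import Data.Fin.Subset using (Subset; inside; outside; ⊤; ⁅_⁆; _∪_; _∈_; _∉_; _⊆_; _-_; ∣_∣; ⋃)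
open import Data.Fin.Subset.Properties using (_∈?_; ⊆-antisym; ⊥⊆; ∣⊥∣≡0; ∣⊤∣≡n; ∈⊤; ∉⊥; ∪-identityˡ; ∪-identityʳ;
  x∈⁅x⁆; x∈⁅y⁆⇒x≡y; x∈p∪q⁺; x∈p∪q⁻; p⊂q⇒∣p∣<∣q∣; p─⊥≡p; p─q⊆p; x∈p∧x≢y⇒x∈p-y)
open import Data.List as List using (List; []; _∷_; _++_; map; concat; filter; length; lookup; allFin)
open import Data.List.Properties using (length-map; length-++; filter-++; filter-≐; filter-none)
open import Data.List.Membership.Propositional using () renaming (_∈_ to _∈ₗ_)
open import Data.List.Membership.Propositional.Properties
  using (∈-map⁻; ∈-concat⁻′; ∈-filter⁺; ∈-filter⁻; ∈-lookup)
open import Data.List.Relation.Binary.Permutation.Propositional using (↭-sym)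
open import Data.List.Relation.Binary.Permutation.Propositional.Properties using (↭-length; ∈-resp-↭)
open import Data.List.Relation.Unary.All as All using (All; []; _∷_)
import Data.List.Relation.Unary.All.Properties as Allₚ
open import Data.List.Relation.Unary.AllPairs as AllPairs using (AllPairs; []; _∷_)
import Data.List.Relation.Unary.AllPairs.Properties as AllPairsₚ
open import Data.List.Relation.Unary.Any as Any using (Any; here; there; index)
open import Data.List.Relation.Unary.Any.Properties using (lookup-index)
open import Data.List.Relation.Unary.Unique.Propositional using (Unique)
import Data.List.Relation.Unary.Unique.Propositional.Properties as Uniqueₚ
open import Data.Nat using (ℕ; zero; suc; 2+; _+_; _*_; _∸_; _^_; _!; _≤_; _<_; z≤n; s≤s; >-nonZero; _≟_; _≤?_)
open import Data.Nat.Combinatorics using (_C_; nC1≡n; nCk+nC[k+1]≡[n+1]C[k+1])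
open import Data.Nat.Induction using (<-rec)
open import Data.Nat.Properties hiding (0≢1+n; suc-injective; _≟_; _≤?_)
open import Data.Nat.Properties using () renaming (suc-injective to ℕ-suc-injective)
open import Data.Nat.Tactic.RingSolver using (solve-∀)
open import Data.Product.Properties using (,-injectiveˡ; ,-injectiveʳ) renaming (≡-dec to ×-≡-dec)
open import Data.Sum using (_⊎_; inj₁; inj₂)
open import Data.Vec using ([]; _∷_; here; there; tabulate) renaming (lookup to lookupᵛ)
open import Data.Vec.Properties using (≡-dec; lookup∘tabulate; []=⇒lookup; lookup⇒[]=; ∷-injectiveʳ)
open import Relation.Nullary.Decidable using (dec-true; map′; _×-dec_; _→-dec_)
open import Relation.Unary using (Decidable)
open import Algebra.Properties.Semiring.Sum +-*-semiring
  using (sum; ∑-comm; *-distribˡ-sum; *-distribʳ-sum; sum-cong-≗; ∑-distrib-+; sum-permute)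

private variable
  k l m n c r s : ℕ
  P Q R V W : Set

-- Counting and conditional expectations

ind : Dec P → ℕ
ind d = if does d then 1 else 0

ind≤1 : (d : Dec P) → ind d ≤ 1
ind≤1 (yes _) = ≤-refl
ind≤1 (no _)  = z≤n

ind-yes : (d : Dec P) → P → ind d ≡ 1
ind-yes (yes _) _ = refl
ind-yes (no ¬p) p = contradiction p ¬p

ind-no : (d : Dec P) → ¬ P → ind d ≡ 0
ind-no (yes p) ¬p = contradiction p ¬p
ind-no (no _)  _  = refl

ind-mono : (d : Dec P) (d′ : Dec Q) → (P → Q) → ind d ≤ ind d′
ind-mono (no _)  _  _ = z≤n
ind-mono (yes p) d′ f = ≤-reflexive (sym (ind-yes d′ (f p)))

ind-∧ : (d : Dec P) (d′ : Dec Q) (d″ : Dec R) → (P → Q → R) → ind d * ind d′ ≤ ind d″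
ind-∧ (no _)  _        _  _ = z≤n
ind-∧ (yes _) (no _)   _  _ = z≤n
ind-∧ (yes p) (yes q)  d″ f = ≤-reflexive (sym (ind-yes d″ (f p q)))

sum-mono : {f g : Fin n → ℕ} → (∀ i → f i ≤ g i) → sum f ≤ sum g
sum-mono {zero}  _ = z≤n
sum-mono {suc n} h = +-mono-≤ (h zero) (sum-mono (h ∘ suc))

sum-mono-< : {f g : Fin (suc n) → ℕ} → (∀ i → f i < g i) → sum f < sum g
sum-mono-< {zero}  h = +-mono-<-≤ (h zero) z≤n
sum-mono-< {suc n} h = +-mono-< (h zero) (sum-mono-< (h ∘ suc))

sum-const : ∀ n x → sum {n} (λ _ → x) ≡ n * x
sum-const zero    x = refl
sum-const (suc n) x = cong (x +_) (sum-const n x)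

term≤sum : (f : Fin n → ℕ) (i : Fin n) → f i ≤ sum f
term≤sum f zero    = m≤m+n _ _
term≤sum f (suc i) = ≤-trans (term≤sum (f ∘ suc) i) (m≤n+m _ _)

sum-ind≤1 : {P : Fin n → Set} (P? : ∀ i → Dec (P i)) →
            (∀ i j → P i → P j → i ≡ j) → sum (λ i → ind (P? i)) ≤ 1
sum-ind≤1 {zero}  P? u = z≤n
sum-ind≤1 {suc n} P? u with P? zero
... | no _  = sum-ind≤1 (P? ∘ suc) (λ i j p q → suc-injective (u _ _ p q))
... | yes p = s≤s (≤-reflexive (trans (sum-cong-≗ (λ i → ind-no (P? (suc i)) (λ q → 0≢1+n (u _ _ p q))))
                                      (trans (sum-const n 0) (*-zeroʳ n))))

sum-involution : (f : Fin n → ℕ) (σ : Fin n → Fin n) → (∀ i → σ (σ i) ≡ i) →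
                 sum (f ∘ σ) ≡ sum f
sum-involution f σ inv = sym (sum-permute f (permutation σ σ inv inv))

average : {f g : Fin n → ℕ} → 1 ≤ n → sum f ≤ sum g → ∃[ i ] f i ≤ g i
average {suc n} {f} {g} _ h with any? (λ i → f i ≤? g i)
... | yes p = p
... | no ¬p = contradiction h (<⇒≱ (sum-mono-< (λ i → ≰⇒> (λ le → ¬p (i , le)))))

average₂ : {f g : Fin m → Fin n → ℕ} → 1 ≤ m → 1 ≤ n →
           sum (λ i → sum (f i)) ≤ sum (λ i → sum (g i)) → ∃[ i ] ∃[ j ] f i j ≤ g i j
average₂ 1≤m 1≤n h with average 1≤m h
... | i , hi = i , average 1≤n hi

-- The method of conditional expectations. For each test h the coordinates i are
-- uniform and independent in Fin M₁ × Fin M₂; coordinate i is acceptable for h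
-- with probability at least K ^ - J h i.
derandomise :
  ∀ N K {L M₁ M₂} {Ok : Fin L → Fin N → Fin M₁ → Fin M₂ → Set} →
  (Ok? : ∀ h i x y → Dec (Ok h i x y)) (J : Fin L → Fin N → ℕ) (w : Fin L → ℕ) →
  1 ≤ M₁ → 1 ≤ M₂ →
  (∀ h i → M₁ * M₂ ≤ sum (λ x → sum (λ y → ind (Ok? h i x y))) * K ^ J h i) →
  Σ (Fin N → Fin M₁) λ ρ → Σ (Fin N → Fin M₂) λ τ →
    sum w ≤ sum (λ h → w h * (ind (all? (λ i → Ok? h i (ρ i) (τ i))) * K ^ sum (J h)))
derandomise zero K Ok? J w _ _ _ = (λ ()) , (λ ()) , ≤-reflexive (sum-cong-≗ (λ h → sym (*-identityʳ (w h))))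
derandomise (suc N) K {L} {M₁} {M₂} {Ok} Ok? J w 1≤M₁ 1≤M₂ dense = ρ , τ , bound
  where
  open ≤-Reasoning
  -- Once the first coordinate is chosen, its factor is absorbed into the weight of the test. This
  -- is why the statement carries weights at all.
  w₁ : Fin M₁ → Fin M₂ → Fin L → ℕ
  w₁ x y h = w h * (ind (Ok? h zero x y) * K ^ J h zero)

  distribute : ∀ h → w h * (sum (λ x → sum (λ y → ind (Ok? h zero x y))) * K ^ J h zero) ≡
                     sum (λ x → sum (λ y → w₁ x y h))
  distribute h = begin-equality
    w h * (sum (λ x → sum (λ y → ind (Ok? h zero x y))) * κ)
      ≡⟨ cong (w h *_) (*-distribʳ-sum κ (λ x → sum (λ y → ind (Ok? h zero x y)))) ⟩
    w h * sum (λ x → sum (λ y → ind (Ok? h zero x y)) * κ)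
      ≡⟨ cong (w h *_) (sum-cong-≗ (λ x → *-distribʳ-sum κ (λ y → ind (Ok? h zero x y)))) ⟩
    w h * sum (λ x → sum (λ y → ind (Ok? h zero x y) * κ))
      ≡⟨ *-distribˡ-sum (w h) (λ x → sum (λ y → ind (Ok? h zero x y) * κ)) ⟩
    sum (λ x → w h * sum (λ y → ind (Ok? h zero x y) * κ))
      ≡⟨ sum-cong-≗ (λ x → *-distribˡ-sum (w h) (λ y → ind (Ok? h zero x y) * κ)) ⟩
    sum (λ x → sum (λ y → w₁ x y h)) ∎
    where κ = K ^ J h zero

  total : sum {M₁} (λ x → sum {M₂} (λ y → sum w)) ≤ sum (λ x → sum (λ y → sum (w₁ x y)))
  total = begin
    sum {M₁} (λ x → sum {M₂} (λ y → sum w))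
      ≡⟨ trans (sum-cong-≗ {M₁} (λ _ → sum-const M₂ (sum w))) (sum-const M₁ (M₂ * sum w)) ⟩
    M₁ * (M₂ * sum w)
      ≡⟨ trans (sym (*-assoc M₁ M₂ (sum w))) (*-comm (M₁ * M₂) (sum w)) ⟩
    sum w * (M₁ * M₂)
      ≡⟨ *-distribʳ-sum (M₁ * M₂) w ⟩
    sum (λ h → w h * (M₁ * M₂))
      ≤⟨ sum-mono (λ h → *-monoʳ-≤ (w h) (dense h zero)) ⟩
    sum (λ h → w h * (sum (λ x → sum (λ y → ind (Ok? h zero x y))) * K ^ J h zero))
      ≡⟨ sum-cong-≗ distribute ⟩
    sum (λ h → sum (λ x → sum (λ y → w₁ x y h)))
      ≡⟨ ∑-comm (λ h x → sum (λ y → w₁ x y h)) ⟩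
    sum (λ x → sum (λ h → sum (λ y → w₁ x y h)))
      ≡⟨ sum-cong-≗ (λ x → ∑-comm (λ h y → w₁ x y h)) ⟩
    sum (λ x → sum (λ y → sum (w₁ x y))) ∎

  pick = average₂ 1≤M₁ 1≤M₂ total
  x₀ = proj₁ pick
  y₀ = proj₁ (proj₂ pick)
  rest = derandomise N K {Ok = λ h i → Ok h (suc i)} (λ h i → Ok? h (suc i)) (λ h i → J h (suc i)) (w₁ x₀ y₀)
           1≤M₁ 1≤M₂ (λ h i → dense h (suc i))
  ρ : Fin (suc N) → Fin M₁
  ρ zero    = x₀
  ρ (suc i) = proj₁ rest i
  τ : Fin (suc N) → Fin M₂
  τ zero    = y₀
  τ (suc i) = proj₁ (proj₂ rest) i

  regroup : ∀ a b c d e → a * (b * c) * (d * e) ≡ a * ((b * d) * (c * e))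
  regroup = solve-∀

  bound : sum w ≤ sum (λ h → w h * (ind (all? (λ i → Ok? h i (ρ i) (τ i))) * K ^ sum (J h)))
  bound = begin
    sum w            ≤⟨ proj₂ (proj₂ pick) ⟩
    sum (w₁ x₀ y₀)   ≤⟨ proj₂ (proj₂ rest) ⟩
    _                ≤⟨ sum-mono (λ h → begin
      w₁ x₀ y₀ h * (A h * K ^ sum (λ i → J h (suc i)))
        ≡⟨ regroup (w h) (ind (Ok? h zero x₀ y₀)) (K ^ J h zero) (A h) _ ⟩
      w h * (ind (Ok? h zero x₀ y₀) * A h * (K ^ J h zero * K ^ sum (λ i → J h (suc i))))
        ≡⟨ cong (λ z → w h * (ind (Ok? h zero x₀ y₀) * A h * z)) (sym (^-distribˡ-+-* K (J h zero) _)) ⟩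
      w h * (ind (Ok? h zero x₀ y₀) * A h * K ^ sum (J h))
        ≤⟨ *-monoʳ-≤ (w h) (*-monoˡ-≤ (K ^ sum (J h))
             (ind-∧ (Ok? h zero x₀ y₀) (all? _) (all? (λ i → Ok? h i (ρ i) (τ i)))
               (λ { p q zero → p ; p q (suc i) → q i }))) ⟩
      w h * (ind (all? (λ i → Ok? h i (ρ i) (τ i))) * K ^ sum (J h)) ∎) ⟩
    _ ∎
    where
    A : Fin L → ℕ
    A h = ind (all? (λ i → Ok? h (suc i) (ρ (suc i)) (τ (suc i))))

-- Finite subsets

∈-image⁺ : (f : Fin k → Fin n) {p : Subset k} {x : Fin k} → x ∈ p → f x ∈ image f p
∈-image⁺ f {p} {x} x∈p = lookup⇒[]= (f x) (image f p)
  (trans (lookup∘tabulate _ (f x)) (dec-true (hit? f p (f x)) (x , x∈p , refl)))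

∈-image⁻ : (f : Fin k → Fin n) (p : Subset k) {y : Fin n} → y ∈ image f p → ∃[ x ] (x ∈ p × f x ≡ y)
∈-image⁻ f p {y} y∈ with hit? f p y | trans (sym (lookup∘tabulate _ y)) ([]=⇒lookup y∈)
... | yes h | _ = h

∣⁅x⁆∪p∣ : (x : Fin n) (p : Subset n) → x ∉ p → ∣ ⁅ x ⁆ ∪ p ∣ ≡ suc ∣ p ∣
∣⁅x⁆∪p∣ zero    (inside  ∷ p) x∉p = contradiction here x∉p
∣⁅x⁆∪p∣ zero    (outside ∷ p) x∉p = cong (suc ∘ ∣_∣) (∪-identityˡ p)
∣⁅x⁆∪p∣ (suc x) (inside  ∷ p) x∉p = cong suc (∣⁅x⁆∪p∣ x p (x∉p ∘ there))
∣⁅x⁆∪p∣ (suc x) (outside ∷ p) x∉p = ∣⁅x⁆∪p∣ x p (x∉p ∘ there)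

∣image∣ : (f : Fin k → Fin n) → Injective _≡_ _≡_ f → ∀ p → ∣ image f p ∣ ≡ ∣ p ∣
∣image∣ {n = n} f inj [] = trans (cong ∣_∣ (⊆-antisym (λ y∈ → contradiction (proj₁ (∈-image⁻ f [] y∈)) λ ()) ⊥⊆)) (∣⊥∣≡0 n)
∣image∣ f inj (outside ∷ p) = trans (cong ∣_∣ (⊆-antisym to from)) (∣image∣ (f ∘ suc) (suc-injective ∘ inj) p)
  where
  to : image f (outside ∷ p) ⊆ image (f ∘ suc) p
  to y∈ with ∈-image⁻ f (outside ∷ p) y∈
  ... | suc x , there x∈p , refl = ∈-image⁺ (f ∘ suc) x∈p
  from : image (f ∘ suc) p ⊆ image f (outside ∷ p)
  from y∈ with ∈-image⁻ (f ∘ suc) p y∈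
  ... | x , x∈p , refl = ∈-image⁺ f {outside ∷ p} (there x∈p)
∣image∣ f inj (inside ∷ p) = begin
  ∣ image f (inside ∷ p) ∣               ≡⟨ cong ∣_∣ (⊆-antisym to from) ⟩
  ∣ ⁅ f zero ⁆ ∪ image (f ∘ suc) p ∣     ≡⟨ ∣⁅x⁆∪p∣ (f zero) _ fresh ⟩
  suc ∣ image (f ∘ suc) p ∣              ≡⟨ cong suc (∣image∣ (f ∘ suc) (suc-injective ∘ inj) p) ⟩
  suc ∣ p ∣ ∎
  where
  open ≡-Reasoning
  to : image f (inside ∷ p) ⊆ ⁅ f zero ⁆ ∪ image (f ∘ suc) p
  to y∈ with ∈-image⁻ f (inside ∷ p) y∈
  ... | zero  , _         , refl = x∈p∪q⁺ (inj₁ (x∈⁅x⁆ (f zero)))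
  ... | suc x , there x∈p , refl = x∈p∪q⁺ (inj₂ (∈-image⁺ (f ∘ suc) x∈p))
  from : ⁅ f zero ⁆ ∪ image (f ∘ suc) p ⊆ image f (inside ∷ p)
  from y∈ with x∈p∪q⁻ ⁅ f zero ⁆ _ y∈
  ... | inj₁ y∈⁅⁆ = subst (_∈ image f (inside ∷ p)) (sym (x∈⁅y⁆⇒x≡y _ y∈⁅⁆)) (∈-image⁺ f {inside ∷ p} here)
  ... | inj₂ y∈im with ∈-image⁻ (f ∘ suc) p y∈im
  ...   | x , x∈p , refl = ∈-image⁺ f {inside ∷ p} (there x∈p)
  fresh : f zero ∉ image (f ∘ suc) p
  fresh y∈ with ∈-image⁻ (f ∘ suc) p y∈
  ... | x , _ , eq = 0≢1+n (sym (inj eq))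

image-injective : (f : Fin k → Fin n) → Injective _≡_ _≡_ f → Injective _≡_ _≡_ (image f)
image-injective f inj {p} {q} eq = ⊆-antisym (half eq) (half (sym eq))
  where
  half : ∀ {p q} → image f p ≡ image f q → p ⊆ q
  half eq x∈p with ∈-image⁻ f _ (subst (_ ∈_) eq (∈-image⁺ f x∈p))
  ... | _ , x′∈q , fx′≡fx = subst (_∈ _) (inj fx′≡fx) x′∈q

⊆∧∣≡∣⇒≡ : {p q : Subset n} → p ⊆ q → ∣ p ∣ ≡ ∣ q ∣ → p ≡ q
⊆∧∣≡∣⇒≡ {p = p} p⊆q eq = ⊆-antisym p⊆q λ {x} x∈q →
  decidable-stable (x ∈? p) (λ x∉p → <⇒≢ (p⊂q⇒∣p∣<∣q∣ (p⊆q , x , x∈q , x∉p)) eq)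

∣p-x∣ : {p : Subset n} {x : Fin n} → x ∈ p → suc ∣ p - x ∣ ≡ ∣ p ∣
∣p-x∣ {p = inside  ∷ p} here        = cong (suc ∘ ∣_∣) (p─⊥≡p p)
∣p-x∣ {p = inside  ∷ p} (there x∈p) = cong suc (∣p-x∣ x∈p)
∣p-x∣ {p = outside ∷ p} (there x∈p) = ∣p-x∣ x∈p

x∉p-x : (p : Subset n) (x : Fin n) → x ∉ p - x
x∉p-x (_ ∷ p) zero    ()
x∉p-x (_ ∷ p) (suc x) (there x∈) = x∉p-x p x x∈

0<∣p∣⇒Nonempty : (p : Subset n) → 0 < ∣ p ∣ → ∃[ x ] x ∈ p
0<∣p∣⇒Nonempty (inside  ∷ p) _  = zero , here
0<∣p∣⇒Nonempty (outside ∷ p) lt with 0<∣p∣⇒Nonempty p lt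
... | x , x∈p = suc x , there x∈p

enumeration : (p : Subset n) → ∃[ x ] (Injective _≡_ _≡_ x × (∀ (i : Fin ∣ p ∣) → x i ∈ p))
enumeration [] = (λ ()) , (λ { {()} }) , (λ ())
enumeration (outside ∷ p) with enumeration p
... | x , inj , x∈p = suc ∘ x , inj ∘ suc-injective , there ∘ x∈p
enumeration {n = suc n} (inside ∷ p) with enumeration p
... | x , inj , x∈p = x′ , inj′ , x′∈
  where
  x′ : Fin (suc ∣ p ∣) → Fin (suc n)
  x′ zero    = zero
  x′ (suc i) = suc (x i)
  inj′ : Injective _≡_ _≡_ x′
  inj′ {zero}  {zero}  _  = refl
  inj′ {suc i} {suc j} eq = cong suc (inj (suc-injective eq))
  x′∈ : ∀ i → x′ i ∈ inside ∷ p
  x′∈ zero    = here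
  x′∈ (suc i) = there (x∈p i)

-- This supplies the permutation of the parts that brings a given type under a prescribed shadow
-- set. If the heads of `p` and `q` differ, take an element i of the set whose head is outside,
-- match the remaining elements by recursion, and compose with the transposition of `zero` and
-- `suc i`.
transport : (p q : Subset n) → ∣ p ∣ ≡ ∣ q ∣ → ∃[ π ] (Injective _≡_ _≡_ π × (∀ (u : Fin n) → π u ∈ q → u ∈ p))
transport [] [] _ = id , id , λ ()
transport {suc n} (a ∷ p) (b ∷ q) eq = go a b eq
  where
  Goal : Subset (suc n) → Subset (suc n) → Set
  Goal p q = ∃[ π ] (Injective _≡_ _≡_ π × (∀ (u : Fin (suc n)) → π u ∈ q → u ∈ p))

  lifted : ∀ a → ∣ p ∣ ≡ ∣ q ∣ → Goal (a ∷ p) (a ∷ q)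
  lifted a eq with transport p q eq
  ... | π , inj , π∈ = π′ , inj′ , π′∈
    where
    π′ : Fin (suc n) → Fin (suc n)
    π′ zero    = zero
    π′ (suc u) = suc (π u)
    inj′ : Injective _≡_ _≡_ π′
    inj′ {zero}  {zero}  _  = refl
    inj′ {suc u} {suc v} eq = cong suc (inj (suc-injective eq))
    π′∈ : ∀ u → π′ u ∈ a ∷ q → u ∈ a ∷ p
    π′∈ zero    here       = here
    π′∈ (suc u) (there u∈) = there (π∈ u u∈)

  go : ∀ a b → ∣ a ∷ p ∣ ≡ ∣ b ∷ q ∣ → Goal (a ∷ p) (b ∷ q)
  go inside  inside  eq = lifted inside (ℕ-suc-injective eq)
  go outside outside eq = lifted outside eq
  go inside outside eq with 0<∣p∣⇒Nonempty q (≤-trans (s≤s z≤n) (≤-reflexive eq))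
  ... | i , i∈q with transport p (q - i) (ℕ-suc-injective (trans eq (sym (∣p-x∣ i∈q))))
  ...   | π , inj , π∈ = π′ , inj′ , π′∈
    where
    π″ : (u : Fin n) → Dec (π u ≡ i) → Fin (suc n)
    π″ u (yes _) = zero
    π″ u (no _)  = suc (π u)
    π′ : Fin (suc n) → Fin (suc n)
    π′ zero    = suc i
    π′ (suc u) = π″ u (π u ≟ᶠ i)
    inj′ : Injective _≡_ _≡_ π′
    inj′ {zero}  {zero}  _ = refl
    inj′ {zero}  {suc v} eq with π v ≟ᶠ i
    ... | no ≢i = contradiction (sym (suc-injective eq)) ≢i
    inj′ {suc u} {zero}  eq with π u ≟ᶠ i
    ... | no ≢i = contradiction (suc-injective eq) ≢i
    inj′ {suc u} {suc v} eq with π u ≟ᶠ i | π v ≟ᶠ i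
    ... | yes a | yes b = cong suc (inj (trans a (sym b)))
    ... | no _  | no _  = cong suc (inj (suc-injective eq))
    π′∈ : ∀ u → π′ u ∈ outside ∷ q → u ∈ inside ∷ p
    π′∈ zero    _ = here
    π′∈ (suc u) u∈ with π u ≟ᶠ i | u∈
    ... | no ≢i | there πu∈q = there (π∈ u (x∈p∧x≢y⇒x∈p-y πu∈q ≢i))
  go outside inside eq with 0<∣p∣⇒Nonempty p (≤-trans (s≤s z≤n) (≤-reflexive (sym eq)))
  ... | i , i∈p with transport (p - i) q (ℕ-suc-injective (trans (∣p-x∣ i∈p) eq))
  ...   | π , inj , π∈ = π′ , inj′ , π′∈
    where
    π″ : (u : Fin n) → Dec (u ≡ i) → Fin (suc n)
    π″ u (yes _) = zero
    π″ u (no _)  = suc (π u)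
    π′ : Fin (suc n) → Fin (suc n)
    π′ zero    = suc (π i)
    π′ (suc u) = π″ u (u ≟ᶠ i)
    inj′ : Injective _≡_ _≡_ π′
    inj′ {zero}  {zero}  _ = refl
    inj′ {zero}  {suc v} eq with v ≟ᶠ i
    ... | no ≢i = contradiction (sym (inj (suc-injective eq))) ≢i
    inj′ {suc u} {zero}  eq with u ≟ᶠ i
    ... | no ≢i = contradiction (inj (suc-injective eq)) ≢i
    inj′ {suc u} {suc v} eq with u ≟ᶠ i | v ≟ᶠ i
    ... | yes a | yes b = cong suc (trans a (sym b))
    ... | no _  | no _  = cong suc (inj (suc-injective eq))
    π′∈ : ∀ u → π′ u ∈ inside ∷ q → u ∈ outside ∷ p
    π′∈ zero    (there πi∈q) = contradiction (π∈ i πi∈q) (x∉p-x p i)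
    π′∈ (suc u) u∈ with u ≟ᶠ i | u∈
    ... | yes refl | _          = there i∈p
    ... | no _     | there πu∈q = there (p─q⊆p p ⁅ i ⁆ (π∈ u πu∈q))

∈-⋃⁻ : (ps : List (Subset n)) {x : Fin n} → x ∈ ⋃ ps → ∃[ p ] (p ∈ₗ ps × x ∈ p)
∈-⋃⁻ []       x∈ = contradiction x∈ ∉⊥
∈-⋃⁻ (p ∷ ps) x∈ with x∈p∪q⁻ p (⋃ ps) x∈
... | inj₁ x∈p = p , here refl , x∈p
... | inj₂ x∈⋃ with ∈-⋃⁻ ps x∈⋃
...   | q , q∈ , x∈q = q , there q∈ , x∈q

length-filter-map : {A B : Set} {P : B → Set} (P? : Decidable P) (f : A → B) (xs : List A) →
                    length (filter P? (map f xs)) ≡ length (filter (P? ∘ f) xs)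
length-filter-map P? f []       = refl
length-filter-map P? f (x ∷ xs) with P? (f x)
... | yes _ = cong suc (length-filter-map P? f xs)
... | no _  = length-filter-map P? f xs

length-filter-⊆ : {A : Set} {P Q : A → Set} (P? : Decidable P) (Q? : Decidable Q) →
                  (∀ x → P x → Q x) → ∀ xs → length (filter P? xs) ≤ length (filter Q? xs)
length-filter-⊆ P? Q? P⊆Q [] = z≤n
length-filter-⊆ P? Q? P⊆Q (x ∷ xs) with P? x | Q? x
... | yes _ | yes _ = s≤s (length-filter-⊆ P? Q? P⊆Q xs)
... | yes p | no ¬q = contradiction (P⊆Q x p) ¬q
... | no _  | yes _ = m≤n⇒m≤1+n (length-filter-⊆ P? Q? P⊆Q xs)
... | no _  | no _  = length-filter-⊆ P? Q? P⊆Q xs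

subsets : ∀ n → ℕ → List (Subset n)
subsets n k = filter (λ p → ∣ p ∣ ≟ k) (allSubsets n)

length-subsets : ∀ n k → length (subsets n k) ≡ n C k
length-subsets zero zero    = refl
length-subsets zero (suc k) = refl
length-subsets (suc n) k = begin
  length (subsets (suc n) k)
    ≡⟨ cong length (filter-++ (λ p → ∣ p ∣ ≟ k) (map (inside ∷_) (allSubsets n)) _) ⟩
  length (filter (λ p → ∣ p ∣ ≟ k) (map (inside ∷_) (allSubsets n)) ++ _)
    ≡⟨ length-++ (filter (λ p → ∣ p ∣ ≟ k) (map (inside ∷_) (allSubsets n))) ⟩
  length (filter (λ p → ∣ p ∣ ≟ k) (map (inside ∷_) (allSubsets n))) + _
    ≡⟨ cong₂ _+_ (length-filter-map (λ p → ∣ p ∣ ≟ k) (inside ∷_) (allSubsets n))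
                 (length-filter-map (λ p → ∣ p ∣ ≟ k) (outside ∷_) (allSubsets n)) ⟩
  length (filter (λ p → suc ∣ p ∣ ≟ k) (allSubsets n)) + length (subsets n k)
    ≡⟨ pascal k ⟩
  suc n C k ∎
  where
  open ≡-Reasoning
  pascal : ∀ k → length (filter (λ p → suc ∣ p ∣ ≟ k) (allSubsets n)) + length (subsets n k) ≡ suc n C k
  pascal zero = cong₂ _+_ (cong length (filter-none (λ p → suc ∣ p ∣ ≟ 0) (All.universal (λ _ ()) (allSubsets n))))
                          (length-subsets n 0)
  pascal (suc k) = trans
    (cong₂ _+_ (trans (cong length (filter-≐ (λ p → suc ∣ p ∣ ≟ suc k) (λ p → ∣ p ∣ ≟ k)
                        (ℕ-suc-injective , cong suc) (allSubsets n)))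
                      (length-subsets n k))
               (length-subsets n (suc k)))
    (nCk+nC[k+1]≡[n+1]C[k+1] n k)

allSubsets-unique : ∀ n → Unique (allSubsets n)
allSubsets-unique zero    = [] ∷ []
allSubsets-unique (suc n) = Uniqueₚ.++⁺
  (Uniqueₚ.map⁺ ∷-injectiveʳ (allSubsets-unique n))
  (Uniqueₚ.map⁺ ∷-injectiveʳ (allSubsets-unique n))
  (λ { (a , b) → differ a b })
  where
  differ : ∀ {p : Subset (suc n)} → p ∈ₗ map (inside ∷_) (allSubsets n) → ¬ p ∈ₗ map (outside ∷_) (allSubsets n)
  differ a b with ∈-map⁻ _ a | ∈-map⁻ _ b
  ... | _ , _ , refl | _ , _ , ()

-- Shadow-disjoint unions

OneToOne : (Fin k → V) → Set
OneToOne ψ = ∀ x y → ψ x ≡ ψ y → x ≡ y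

injection : {ψ : Fin k → V} → OneToOne ψ → Injective _≡_ _≡_ ψ
injection inj {x} {y} = inj x y

-- Equality of the images of `S` and `S′`, spelled out by elements because the target is an
-- arbitrary type, such as pairs of a part and a position in it.
Coincide : (Fin k → V) → Subset k → (Fin k → V) → Subset k → Set
Coincide ψ S ψ′ S′ = (∀ v → v ∈ S → ∃[ v′ ] (v′ ∈ S′ × ψ v ≡ ψ′ v′)) ×
                     (∀ v′ → v′ ∈ S′ → ∃[ v ] (v ∈ S × ψ v ≡ ψ′ v′))

Disjoint : List (Subset k) → (Fin k → V) → (Fin k → V) → Set
Disjoint F ψ ψ′ = ∀ S S′ → S ∈ₗ F → S′ ∈ₗ F → ¬ Coincide ψ S ψ′ S′

preimage : (Fin k → Fin n) → Subset n → Subset k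
preimage f p = tabulate (lookupᵛ p ∘ f)

∈-preimage⁺ : (f : Fin k → Fin n) (p : Subset n) {x : Fin k} → f x ∈ p → x ∈ preimage f p
∈-preimage⁺ f p {x} fx∈p = lookup⇒[]= x _ (trans (lookup∘tabulate _ x) ([]=⇒lookup fx∈p))

∈-preimage⁻ : (f : Fin k → Fin n) (p : Subset n) {x : Fin k} → x ∈ preimage f p → f x ∈ p
∈-preimage⁻ f p {x} x∈ = lookup⇒[]= (f x) p (trans (sym (lookup∘tabulate _ x)) ([]=⇒lookup x∈))

∈-∂ : (G : RGraph r k) {S p : Subset k} → ∣ S ∣ ≡ r ∸ 1 → S ⊆ p → p ∈ₗ edges G → S ∈ₗ ∂ G
∈-∂ G {S} ∣S∣ S⊆p p∈G = ∈-filter⁺ _ (∈-allSubsets S) (∣S∣ , Any.map (λ { refl {x} → S⊆p {x} }) p∈G)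

module _ (G : RGraph r k) {ψ ψ′ : Fin k → Fin n}
         (inj : OneToOne ψ) (inj′ : OneToOne ψ′) where

  image-preimage : (ψ : Fin k → Fin n) (A : Subset n) {d : Subset k} → A ⊆ image ψ d →
                   image ψ (preimage ψ A) ≡ A
  image-preimage ψ A {d} A⊆ = ⊆-antisym to from
    where
    to : image ψ (preimage ψ A) ⊆ A
    to y∈ with ∈-image⁻ ψ _ y∈
    ... | x , x∈ , refl = ∈-preimage⁻ ψ A x∈
    from : A ⊆ image ψ (preimage ψ A)
    from y∈A with ∈-image⁻ ψ d (A⊆ y∈A)
    ... | x , _ , refl = ∈-image⁺ ψ (∈-preimage⁺ ψ A y∈A)

  preimage-⊆ : {ψ : Fin k → Fin n} → OneToOne ψ → (A : Subset n) {d : Subset k} →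
               A ⊆ image ψ d → preimage ψ A ⊆ d
  preimage-⊆ {ψ} inj A {d} A⊆ x∈ with ∈-image⁻ ψ d (A⊆ (∈-preimage⁻ ψ A x∈))
  ... | x′ , x′∈d , eq = subst (_∈ d) (inj _ _ eq) x′∈d

  preimage-∈-∂ : {ψ : Fin k → Fin n} → OneToOne ψ → (A : Subset n) {d : Subset k} →
                 ∣ A ∣ ≡ r ∸ 1 → d ∈ₗ edges G → A ⊆ image ψ d → preimage ψ A ∈ₗ ∂ G
  preimage-∈-∂ {ψ} inj A ∣A∣ d∈ A⊆ = ∈-∂ G
    (trans (sym (∣image∣ ψ (injection inj) _)) (trans (cong ∣_∣ (image-preimage ψ A A⊆)) ∣A∣))
    (preimage-⊆ inj A A⊆) d∈

  -- An (r - 1)-set below edges of both copies pulls back along either map to a member of ∂G, and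
  -- the two pullbacks have the same image.
  common-shadow : Disjoint (∂ G) ψ ψ′ → (A : Subset n) {d d′ : Subset k} → ∣ A ∣ ≡ r ∸ 1 →
                  d ∈ₗ edges G → d′ ∈ₗ edges G → A ⊆ image ψ d → ¬ A ⊆ image ψ′ d′
  common-shadow disjoint A {d} {d′} ∣A∣ d∈ d′∈ A⊆ A⊆′ = disjoint _ _
    (preimage-∈-∂ inj A ∣A∣ d∈ A⊆) (preimage-∈-∂ inj′ A ∣A∣ d′∈ A⊆′) (to , from)
    where
    to : ∀ v → v ∈ preimage ψ A → ∃[ v′ ] (v′ ∈ preimage ψ′ A × ψ v ≡ ψ′ v′)
    to v v∈ with ∈-image⁻ ψ′ d′ (A⊆′ (∈-preimage⁻ ψ A v∈))
    ... | v′ , _ , eq = v′ , ∈-preimage⁺ ψ′ A (subst (_∈ A) (sym eq) (∈-preimage⁻ ψ A v∈)) , sym eq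
    from : ∀ v′ → v′ ∈ preimage ψ′ A → ∃[ v ] (v ∈ preimage ψ A × ψ v ≡ ψ′ v′)
    from v′ v′∈ with ∈-image⁻ ψ d (A⊆ (∈-preimage⁻ ψ′ A v′∈))
    ... | v , _ , eq = v , ∈-preimage⁺ ψ A (subst (_∈ A) (sym eq) (∈-preimage⁻ ψ′ A v′∈)) , eq

image-cancel : {ψ : Fin k → Fin n} → OneToOne ψ → (g : Fin l → Fin n) (g′ : Fin l → Fin k) →
               (∀ x → ψ (g′ x) ≡ g x) → ∀ p d → image g p ≡ image ψ d → image g′ p ≡ d
image-cancel {ψ = ψ} ψ-inj g g′ lift p d eq = ⊆-antisym to from
  where
  to : image g′ p ⊆ d
  to y∈ with ∈-image⁻ g′ p y∈
  ... | x , x∈p , refl with ∈-image⁻ ψ d (subst (_∈ image ψ d) (sym (lift x))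
                              (subst (g x ∈_) eq (∈-image⁺ g x∈p)))
  ...   | y , y∈d , ψy = subst (_∈ d) (ψ-inj _ _ ψy) y∈d
  from : d ⊆ image g′ p
  from {y} y∈d with ∈-image⁻ g p (subst (ψ y ∈_) (sym eq) (∈-image⁺ ψ y∈d))
  ... | x , x∈p , gx = subst (_∈ image g′ p) (ψ-inj _ _ (trans (lift x) gx)) (∈-image⁺ g′ x∈p)

AllPairs-compare : {A : Set} {R : A → A → Set} {xs : List A} → AllPairs R xs → ∀ {x y} →
                   x ∈ₗ xs → y ∈ₗ xs → x ≡ y ⊎ R x y ⊎ R y x
AllPairs-compare (_ ∷ _)   (here refl) (here refl) = inj₁ refl
AllPairs-compare (rs ∷ _)  (here refl) (there y∈)  = inj₂ (inj₁ (All.lookup rs y∈))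
AllPairs-compare (rs ∷ _)  (there x∈)  (here refl) = inj₂ (inj₂ (All.lookup rs x∈))
AllPairs-compare (_ ∷ rss) (there x∈)  (there y∈)  = AllPairs-compare rss x∈ y∈

-- Strong induction on the position in the tight order: the property spreads from an earlier edge
-- across the set `p - v` shared with it. The base case is phrased by `toℕ i ≡ 0` so that it makes
-- sense for an empty list too.
tight-induction : (es : List (Subset l)) → TightOrder es → (P : Subset l → Set) →
                  (∀ i → toℕ i ≡ 0 → P (lookup es i)) →
                  (∀ p q v → p ∈ₗ es → v ∈ p → p - v ⊆ q → P q → P p) →
                  ∀ p → p ∈ₗ es → P p
tight-induction es order P base step p p∈ =
  subst P (sym (lookup-index p∈)) (<-rec (λ t → ∀ i → toℕ i ≡ t → P (lookup es i)) go _ (index p∈) refl)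
  where
  go : ∀ t → (∀ {t′} → t′ < t → ∀ i → toℕ i ≡ t′ → P (lookup es i)) →
       ∀ i → toℕ i ≡ t → P (lookup es i)
  go zero    rec i eq = base i eq
  go (suc t) rec i eq with order i (≤-trans (s≤s z≤n) (≤-reflexive (sym eq)))
  ... | v , s , v∈ , s<i , _ , sub =
    step (lookup es i) (lookup es s) v (∈-lookup i) v∈ sub (rec (≤-trans s<i (≤-reflexive eq)) s refl)

-- Each edge of a tight tree shares an (r − 1)-set with an earlier one, so a tight
-- tree in a shadow-disjoint union lies within one of the parts.
module Union (G : RGraph r k) (1≤r : 1 ≤ r) (Ψ : List (Fin k → Fin n))
             (injective : All OneToOne Ψ) (disjoint : AllPairs (Disjoint (∂ G)) Ψ) where

  copy : (Fin k → Fin n) → List (Subset n)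
  copy ψ = map (image ψ) (edges G)

  pairs : AllPairs (λ ψ ψ′ → OneToOne ψ × OneToOne ψ′ × Disjoint (∂ G) ψ ψ′) Ψ
  pairs = go injective disjoint
    where
    go : ∀ {Ψ : List (Fin k → Fin n)} → All OneToOne Ψ → AllPairs (Disjoint (∂ G)) Ψ →
         AllPairs (λ ψ ψ′ → OneToOne ψ × OneToOne ψ′ × Disjoint (∂ G) ψ ψ′) Ψ
    go []       []       = []
    go (i ∷ is) (d ∷ ds) = All.zipWith (λ (i′ , d′) → i , i′ , d′) (is , d) ∷ go is ds

  union : RGraph r n
  union = record
    { edges    = concat (map copy Ψ)
    ; uniform  = Allₚ.concat⁺ (Allₚ.map⁺ (All.map (λ {ψ} inj →
        Allₚ.map⁺ (All.map (λ {p} → trans (∣image∣ ψ (injection inj) p)) (uniform G))) injective))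
    ; distinct = Uniqueₚ.concat⁺
        (Allₚ.map⁺ (All.map (λ {ψ} inj → Uniqueₚ.map⁺ (image-injective ψ (injection inj)) (distinct G)) injective))
        (AllPairsₚ.map⁺ (AllPairs.map apart pairs))
    }
    where
    -- Shadow-disjoint copies are edge-disjoint: an edge in both, minus one of its vertices, would
    -- be a common shadow set. The vertex exists because of `1 ≤ r`.
    apart : ∀ {ψ ψ′} → OneToOne ψ × OneToOne ψ′ × Disjoint (∂ G) ψ ψ′ →
            ∀ {p} → ¬ (p ∈ₗ copy ψ × p ∈ₗ copy ψ′)
    apart {ψ} {ψ′} (inj , inj′ , dis) (p∈ , p∈′) with ∈-map⁻ (image ψ) p∈ | ∈-map⁻ (image ψ′) p∈′
    ... | d , d∈ , refl | d′ , d′∈ , eq with 0<∣p∣⇒Nonempty (image ψ d)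
             (subst (0 <_) (sym (trans (∣image∣ ψ (injection inj) d) (All.lookup (uniform G) d∈))) 1≤r)
    ...   | x , x∈ = common-shadow G inj inj′ dis (image ψ d - x)
              (cong (_∸ 1) (trans (∣p-x∣ x∈) (trans (∣image∣ ψ (injection inj) d) (All.lookup (uniform G) d∈))))
              d∈ d′∈ (p─q⊆p (image ψ d) _) (subst (image ψ d - x ⊆_) eq (p─q⊆p (image ψ d) _))

  e-union : e union ≡ length Ψ * e G
  e-union = go Ψ
    where
    go : ∀ Ψ → length (concat (map copy Ψ)) ≡ length Ψ * e G
    go []      = refl
    go (ψ ∷ Ψ) = trans (length-++ (copy ψ)) (cong₂ _+_ (length-map (image ψ) (edges G)) (go Ψ))

  -- Since the edges of `T` span its vertex set, every vertex of `T` is sent into the range of `ψ`,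
  -- and the embedding can be pulled back through `ψ`.
  factor : (ψ : Fin k → Fin n) → OneToOne ψ → (T : RGraph r l) → IsTightTree T →
           (g : Fin l → Fin n) → Injective _≡_ _≡_ g →
           All (λ p → ∃[ d ] (d ∈ₗ edges G × image g p ≡ image ψ d)) (edges T) → Contains G T
  factor {l} ψ ψ-inj T tight g g-inj homes = g′ , g′-inj , All.map g′-edges homes
    where
    lift : ∀ x → ∃[ y ] ψ y ≡ g x
    lift x with ∈-⋃⁻ (edges T) (subst (x ∈_) (sym (IsTightTree.spanning tight)) ∈⊤)
    ... | p , p∈ , x∈p with All.lookup homes p∈
    ...   | d , _ , eq with ∈-image⁻ ψ d (subst (g x ∈_) eq (∈-image⁺ g x∈p))
    ...     | y , _ , ψy = y , ψy

    g′ : Fin l → Fin k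
    g′ = proj₁ ∘ lift

    g′-inj : Injective _≡_ _≡_ g′
    g′-inj {x} {y} eq = g-inj (trans (sym (proj₂ (lift x))) (trans (cong ψ eq) (proj₂ (lift y))))

    g′-edges : ∀ {p} → ∃[ d ] (d ∈ₗ edges G × image g p ≡ image ψ d) → image g′ p ∈ₗ edges G
    g′-edges {p} (d , d∈ , eq) = subst (_∈ₗ edges G) (sym (image-cancel ψ-inj g g′ (proj₂ ∘ lift) p d eq)) d∈

  union-avoids : (T : RGraph r l) → IsTightTree T → 1 ≤ e T → ¬ Contains G T → ¬ Contains union T
  union-avoids {l} T tight 1≤e avoid (g , g-inj , g-edges)
    with es , es↭T , order ← IsTightTree.ordering tight = 
    avoid (factor (proj₁ root) (All.lookup injective (proj₁ (proj₂ root))) T tight g g-inj home-edges)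
    where
    Home : (Fin k → Fin n) → Subset l → Set
    Home ψ p = ∃[ d ] (d ∈ₗ edges G × image g p ≡ image ψ d)

    some-home : ∀ {p} → p ∈ₗ es → ∃[ ψ ] (ψ ∈ₗ Ψ × Home ψ p)
    some-home p∈ with ∈-concat⁻′ (map copy Ψ) (All.lookup g-edges (∈-resp-↭ es↭T p∈))
    ... | _ , gp∈ , c∈ with ∈-map⁻ copy c∈
    ...   | ψ , ψ∈ , refl with ∈-map⁻ (image ψ) gp∈
    ...     | d , d∈ , eq = ψ , ψ∈ , d , d∈ , eq

    size : ∀ {p} → p ∈ₗ es → ∣ p ∣ ≡ r
    size p∈ = All.lookup (uniform T) (∈-resp-↭ es↭T p∈)

    step : ∀ {ψ} → ψ ∈ₗ Ψ → ∀ p q v → p ∈ₗ es → v ∈ p → p - v ⊆ q → Home ψ q → Home ψ p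
    step {ψ} ψ∈ p q v p∈ v∈p sub (d , d∈ , eq) with some-home p∈
    ... | ψ′ , ψ′∈ , d′ , d′∈ , eq′ = same (AllPairs-compare pairs ψ∈ ψ′∈)
      where
      A : Subset n
      A = image g (p - v)
      ∣A∣ : ∣ A ∣ ≡ r ∸ 1
      ∣A∣ = trans (∣image∣ g g-inj (p - v)) (cong (_∸ 1) (trans (∣p-x∣ v∈p) (size p∈)))
      A⊆ : A ⊆ image ψ d
      A⊆ y∈ with ∈-image⁻ g (p - v) y∈
      ... | x , x∈ , refl = subst (g x ∈_) eq (∈-image⁺ g (sub x∈))
      A⊆′ : A ⊆ image ψ′ d′
      A⊆′ y∈ with ∈-image⁻ g (p - v) y∈
      ... | x , x∈ , refl = subst (g x ∈_) eq′ (∈-image⁺ g (p─q⊆p p _ x∈))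
      same : ψ ≡ ψ′ ⊎ (OneToOne ψ × OneToOne ψ′ × Disjoint (∂ G) ψ ψ′) ⊎
                      (OneToOne ψ′ × OneToOne ψ × Disjoint (∂ G) ψ′ ψ) → Home ψ p
      same (inj₁ refl) = d′ , d′∈ , eq′
      same (inj₂ (inj₁ (inj , inj′ , dis))) = ⊥-elim (common-shadow G inj inj′ dis A ∣A∣ d∈ d′∈ A⊆ A⊆′)
      same (inj₂ (inj₂ (inj′ , inj , dis))) = ⊥-elim (common-shadow G inj′ inj dis A ∣A∣ d′∈ d∈ A⊆′ A⊆)

    first : ∀ es → (∀ {p} → p ∈ₗ es → ∃[ ψ ] (ψ ∈ₗ Ψ × Home ψ p)) → 1 ≤ length es →
            ∃[ ψ ] (ψ ∈ₗ Ψ × ∀ i → toℕ i ≡ 0 → Home ψ (lookup es i))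
    first (_ ∷ _) some _ with some (here refl)
    ... | ψ , ψ∈ , home₀ = ψ , ψ∈ , λ { zero _ → home₀ }

    root : ∃[ ψ ] (ψ ∈ₗ Ψ × ∀ i → toℕ i ≡ 0 → Home ψ (lookup es i))
    root = first es some-home (subst (1 ≤_) (sym (↭-length es↭T)) 1≤e)

    home-edges : All (Home (proj₁ root)) (edges T)
    home-edges = All.tabulate λ p∈ → tight-induction es order (Home (proj₁ root)) (proj₂ (proj₂ root))
      (step (proj₁ (proj₂ root))) _ (∈-resp-↭ (↭-sym es↭T) p∈)

∣∂∣≤ : (G : RGraph r n) → length (∂ G) ≤ n C (r ∸ 1)
∣∂∣≤ {r} {n} G = ≤-trans
  (length-filter-⊆ _ (λ p → ∣ p ∣ ≟ r ∸ 1) (λ _ → proj₁) (allSubsets n))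
  (≤-reflexive (length-subsets n (r ∸ 1)))

-- For t = 1 the shadow bound says that `G` has no edge. The only edge of `T` is its whole vertex
-- set, so listing the elements of any edge of `G` embeds `T`.
single-edge : (T : RGraph r k) → IsTightTree T → e T ≡ 1 → (G : RGraph r n) → 1 ≤ e G → Contains G T
single-edge {r} {k} {n} T tight eT G 1≤e = go (edges T) (uniform T) (IsTightTree.spanning tight) eT (edges G) (uniform G) 1≤e
  where
  go : ∀ es → All (λ p → ∣ p ∣ ≡ r) es → ⋃ es ≡ ⊤ → length es ≡ 1 →
       ∀ ds → All (λ p → ∣ p ∣ ≡ r) ds → 1 ≤ length ds →
       Σ (Fin k → Fin n) λ f → Injective _≡_ _≡_ f × All (λ p → image f p ∈ₗ ds) es
  go (p ∷ []) (∣p∣ ∷ []) span refl (d ∷ _) (∣d∣ ∷ _) _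
    with refl ← trans (sym (∪-identityʳ p)) span
    with refl ← trans (sym (∣⊤∣≡n k)) (trans ∣p∣ (sym ∣d∣))
    with x , inj , x∈d ← enumeration d = x , inj , here (⊆∧∣≡∣⇒≡ sub (trans (∣image∣ x inj ⊤) (∣⊤∣≡n ∣ d ∣))) ∷ []
    where
    sub : image x ⊤ ⊆ d
    sub y∈ with ∈-image⁻ x ⊤ y∈
    ... | i , _ , refl = x∈d i

-- Packings in complete multipartite hypergraphs

^-distribʳ-* : ∀ a b s → (a * b) ^ s ≡ a ^ s * b ^ s
^-distribʳ-* a b zero    = refl
^-distribʳ-* a b (suc s) = trans (cong (a * b *_) (^-distribʳ-* a b s)) (interchange a b (a ^ s) (b ^ s))
  where
  interchange : ∀ a b c d → (a * b) * (c * d) ≡ (a * c) * (b * d)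
  interchange = solve-∀

length-filter-tabulate : {A : Set} {P : A → Set} (P? : Decidable P) (f : Fin n → A) →
                         length (filter P? (List.tabulate f)) ≡ sum (λ i → ind (P? (f i)))
length-filter-tabulate {zero}  P? f = refl
length-filter-tabulate {suc n} P? f with P? (f zero)
... | yes _ = cong suc (length-filter-tabulate P? (f ∘ suc))
... | no _  = length-filter-tabulate P? (f ∘ suc)

length-concat-tabulate : {A : Set} (f : Fin n → List A) → (∀ i → length (f i) ≡ m) →
                         length (concat (List.tabulate f)) ≡ n * m
length-concat-tabulate {zero}  f eq = refl
length-concat-tabulate {suc n} f eq =
  trans (length-++ (f zero)) (cong₂ _+_ (eq zero) (length-concat-tabulate (f ∘ suc) (eq ∘ suc)))

funToFin-cong : {f g : Fin m → Fin n} → f ≗ g → funToFin f ≡ funToFin g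
funToFin-cong {zero}  f≗g = refl
funToFin-cong {suc m} f≗g = cong₂ combine (f≗g zero) (funToFin-cong (f≗g ∘ suc))

finToFun-injective : {i j : Fin (n ^ m)} → finToFun {n} {m} i ≗ finToFun j → i ≡ j
finToFun-injective {n} {m} {i} {j} eq = trans (sym (funToFin-finToFin {m} {n} i))
  (trans (funToFin-cong eq) (funToFin-finToFin {m} {n} j))

combine-cancel : {i k : Fin m} {j l : Fin n} → combine i j ≡ combine k l → (i , j) ≡ (k , l)
combine-cancel {i = i} {k} {j} {l} eq with refl , refl ← combine-injective i j k l eq = refl

enumerate : ∀ {s} (p : Subset n) → ∣ p ∣ ≡ s → ∃[ x ] (OneToOne x × (∀ (i : Fin s) → x i ∈ p))
enumerate p refl with x , inj , x∈p ← enumeration p = x , (λ _ _ → inj) , x∈p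

Disjoint-∘ : (F : List (Subset k)) (g : V → W) → (∀ x y → g x ≡ g y → x ≡ y) → {ψ ψ′ : Fin k → V} →
             Disjoint F ψ ψ′ → Disjoint F (g ∘ ψ) (g ∘ ψ′)
Disjoint-∘ F g inj dis S S′ S∈ S′∈ (to , from) = dis S S′ S∈ S′∈
  ((λ v v∈ → let (v′ , v′∈ , eq) = to v v∈ in v′ , v′∈ , inj _ _ eq) ,
   (λ v′ v′∈ → let (v , v∈ , eq) = from v′ v′∈ in v , v∈ , inj _ _ eq))

coincide? : (∀ (x y : V) → Dec (x ≡ y)) → (ψ : Fin k → V) (S : Subset k) (ψ′ : Fin k → V) (S′ : Subset k) →
            Dec (Coincide ψ S ψ′ S′)
coincide? _≟_ ψ S ψ′ S′ =
  all? (λ v → (v ∈? S) →-dec any? (λ v′ → (v′ ∈? S′) ×-dec (ψ v ≟ ψ′ v′)))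
  ×-dec
  all? (λ v′ → (v′ ∈? S′) →-dec any? (λ v → (v ∈? S) ×-dec (ψ v ≟ ψ′ v′)))

disjoint? : (∀ (x y : V) → Dec (x ≡ y)) → (F : List (Subset k)) (ψ ψ′ : Fin k → V) → Dec (Disjoint F ψ ψ′)
disjoint? _≟_ F ψ ψ′ = map′
  (λ all S S′ S∈ S′∈ → All.lookup (All.lookup all S∈) S′∈)
  (λ dis → All.tabulate λ {S} S∈ → All.tabulate λ {S′} S′∈ → dis S S′ S∈ S′∈)
  (All.all? (λ S → All.all? (λ S′ → ¬? (coincide? _≟_ ψ S ψ′ S′)) F) F)

-- Copies of F in the complete n-partite s-graph with parts of size c.
record Packing (F : List (Subset k)) (n c : ℕ) : Set where
  field
    copies      : List (Fin k → Fin n × Fin c)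
    transversal : All (λ ψ → OneToOne (proj₁ ∘ ψ)) copies
    disjoint    : AllPairs (Disjoint F) copies

-- A decomposition of the transversal s-sets into transversals.
record Code (s n c : ℕ) : Set where
  field
    size   : ℕ
    word   : Fin size → Fin n → Fin c
    count  : size ≡ c ^ s
    unique : ∀ i j (x : Fin s → Fin n) → OneToOne x → (∀ a → word i (x a) ≡ word j (x a)) → i ≡ j

-- The transversal s-set over `T` is encoded by a section `b` of all parts, read only on `T`. For a
-- transversal copy and sets `S`, `T` of equal size, fitting means that the image of `S` is exactly
-- this s-set.
Fits : (Fin k → Fin n × Fin c) → Subset k → (Fin n → Fin c) → Subset n → Set
Fits ψ S b T = ∀ v → v ∈ S → proj₁ (ψ v) ∈ T × proj₂ (ψ v) ≡ b (proj₁ (ψ v))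

fits? : (ψ : Fin k → Fin n × Fin c) (S : Subset k) (b : Fin n → Fin c) (T : Subset n) → Dec (Fits ψ S b T)
fits? ψ S b T = all? (λ v → (v ∈? S) →-dec ((proj₁ (ψ v) ∈? T) ×-dec (proj₂ (ψ v) ≟ᶠ b (proj₁ (ψ v)))))

Covered : List (Subset k) → List (Fin k → Fin n × Fin c) → (Fin n → Fin c) → Subset n → Set
Covered F Ψ b T = Any (λ ψ → Any (λ S → Fits ψ S b T) F) Ψ

covered? : (F : List (Subset k)) (Ψ : List (Fin k → Fin n × Fin c)) (b : Fin n → Fin c) (T : Subset n) → Dec (Covered F Ψ b T)
covered? F Ψ b T = Any.any? (λ ψ → Any.any? (λ S → fits? ψ S b T) F) Ψ

-- Counting full sections weights all transversals over `T` equally and gives every type the same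
-- total `c ^ n`, so that fractions can be compared across types.
uncovered : (F : List (Subset k)) (Ψ : List (Fin k → Fin n × Fin c)) → Subset n → ℕ
uncovered {n = n} {c} F Ψ T = sum {c ^ n} (λ b → ind (¬? (covered? F Ψ (finToFun b) T)))

-- P and P⁺ are two decompositions of the transversal s-sets over n · c points;
-- a word of P and a word of P⁺ agree in at most s points.
module Increment
  {k s : ℕ} (F : List (Subset k)) (∣F∣ : ∀ S → S ∈ₗ F → ∣ S ∣ ≡ s)
  {n c : ℕ} (ι : Fin k → Fin n) (ι-inj : OneToOne ι) (1≤c : 1 ≤ c)
  (Ψ : Packing F n c) (C : Code s n c)
  {q : ℕ} (P P⁺ : Fin (q ^ s) → Fin (n * c) → Fin q)
  (P-unique : ∀ i j (x : Fin s → Fin (n * c)) → OneToOne x → (∀ a → P i (x a) ≡ P j (x a)) → i ≡ j)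
  (P⁺-unique : ∀ i j (x : Fin s → Fin (n * c)) → OneToOne x → (∀ a → P⁺ i (x a) ≡ P⁺ j (x a)) → i ≡ j)
  (P-P⁺ : ∀ i j (x : Fin (suc s) → Fin (n * c)) → OneToOne x → ¬ (∀ a → P i (x a) ≡ P⁺ j (x a)))
  (T : Subset n) (∣T∣ : ∣ T ∣ ≡ s)
  (K : ℕ) (1≤K : 1 ≤ K) (dense : c ^ n ≤ K * uncovered F (Packing.copies Ψ) T)
  (1≤E : 1 ≤ length F)
  where

  open Packing Ψ
  open Code C

  E N L : ℕ
  E = length F
  N = q ^ s
  L = size * N

  point : Fin n × Fin c → Fin (n * c)
  point (u , y) = combine u y

  point-injective : ∀ x y → point x ≡ point y → x ≡ y
  point-injective (u , y) (u′ , y′) = combine-cancel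

  -- A vertex of the blow-up is an old point together with a label below `q`. The labelling `f`
  -- lifts the old points to its own graph.
  extend : (Fin (n * c) → Fin q) → Fin n × Fin c → Fin n × Fin (c * q)
  extend f (u , y) = u , combine y (f (combine u y))

  extend-cancel : ∀ f g x y → extend f x ≡ extend g y → x ≡ y × f (point x) ≡ g (point x)
  extend-cancel f g (u , y) (u′ , y′) eq with ,-injectiveˡ eq | combine-injective y _ y′ _ (,-injectiveʳ eq)
  ... | refl | refl , eq′ = refl , eq′

  extend-agree : ∀ f g x y → extend f x ≡ extend g y → f (point x) ≡ g (point x)
  extend-agree f g x y eq with extend-cancel f g x y eq
  ... | refl , eq′ = eq′

  extend-agreeʳ : ∀ f g x y → extend f x ≡ extend g y → f (point y) ≡ g (point y)
  extend-agreeʳ f g x y eq with extend-cancel f g x y eq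
  ... | refl , eq′ = eq′

  lower : Fin L → Fin size
  lower h = proj₁ (remQuot {size} N h)

  upper : Fin L → Fin N
  upper h = proj₂ (remQuot {size} N h)

  base : Fin L → Fin n → Fin n × Fin c
  base h u = u , word (lower h) u

  word′ : Fin L → Fin n → Fin (c * q)
  word′ h u = proj₂ (extend (P⁺ (upper h)) (base h u))

  -- The product of the old code with the monic polynomials: agreement in s parts first identifies
  -- the old words, and then, at s common points, the polynomials.
  code′ : Code s n (c * q)
  code′ = record
    { size   = L
    ; word   = word′
    ; count  = trans (cong (_* N) count) (sym (^-distribʳ-* c q s))
    ; unique = unique′
    }
    where
    unique′ : ∀ h h′ x → OneToOne x → (∀ a → word′ h (x a) ≡ word′ h′ (x a)) → h ≡ h′
    unique′ h h′ x x-inj eq = trans (sym (combine-remQuot {size} N h))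
      (trans (cong₂ combine first second) (combine-remQuot {size} N h′))
      where
      both : ∀ a → base h (x a) ≡ base h′ (x a) × _
      both a = extend-cancel (P⁺ (upper h)) (P⁺ (upper h′)) (base h (x a)) (base h′ (x a)) (cong (x a ,_) (eq a))
      first = unique _ _ x x-inj (λ a → ,-injectiveʳ (proj₁ (both a)))
      second = P⁺-unique _ _ (λ a → point (base h (x a)))
        (λ a b e → x-inj a b (,-injectiveˡ (point-injective _ _ e)))
        (λ a → proj₂ (both a))

  new : Fin L → Fin k → Fin n × Fin (c * q)
  new h = extend (P⁺ (upper h)) ∘ base h ∘ ι

  F-at : Fin E → Subset k
  F-at = lookup F

  ∣F-at∣ : ∀ j → ∣ F-at j ∣ ≡ s
  ∣F-at∣ j = ∣F∣ (F-at j) (∈-lookup j)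

  -- After this permutation, the part of the old packing lying over the parts of the j-th shadow set
  -- is the part that was over `T`, where many transversals are uncovered.
  perm : ∀ j → ∃[ π ] (Injective _≡_ _≡_ π × (∀ u → π u ∈ image ι (F-at j) → u ∈ T))
  perm j = transport T (image ι (F-at j))
    (trans ∣T∣ (sym (trans (∣image∣ ι (injection ι-inj) (F-at j)) (∣F-at∣ j))))

  π : Fin E → Fin n → Fin n
  π j = proj₁ (perm j)

  π-inj : ∀ j → OneToOne (π j)
  π-inj j u v = proj₁ (proj₂ (perm j))

  π-T : ∀ j u → π j u ∈ image ι (F-at j) → u ∈ T
  π-T j = proj₂ (proj₂ (perm j))

  -- A reflection randomises each part just as a translation would, and has the convenience of being
  -- its own inverse.
  move : Fin E → (Fin n → Fin c) → Fin n × Fin c → Fin n × Fin c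
  move j a (u , y) = π j u , reflect (a u) y

  move-injective : ∀ j a x y → move j a x ≡ move j a y → x ≡ y
  move-injective j a (u , y) (u′ , y′) eq with π-inj j u u′ (,-injectiveˡ eq)
  ... | refl = cong (u ,_) (trans (sym (reflect-involutive (a u) y))
    (trans (cong (reflect (a u)) (,-injectiveʳ eq)) (reflect-involutive (a u) y′)))

  old : Fin N → Fin E → (Fin n → Fin c) → Fin n × Fin c → Fin n × Fin (c * q)
  old i j a = extend (P i) ∘ move j a

  old-injective : ∀ i j a x y → old i j a x ≡ old i j a y → x ≡ y
  old-injective i j a x y eq = move-injective j a x y (proj₁ (extend-cancel (P i) (P i) (move j a x) (move j a y) eq))

  -- The images of `S` under the new copy `h` lie on the lift by the word `i` of `P`. Old copies
  -- placed on `i` can share this shadow set with `h` only in that case.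
  Agree : Fin L → Fin N → Subset k → Set
  Agree h i S = ∀ v → v ∈ S → P i (point (base h (ι v))) ≡ P⁺ (upper h) (point (base h (ι v)))

  agree? : ∀ h i S → Dec (Agree h i S)
  agree? h i S = all? (λ v → (v ∈? S) →-dec (_ ≟ᶠ _))

  coincide-agree : ∀ h i j a (ψ : Fin k → Fin n × Fin c) S S′ → Coincide (old i j a ∘ ψ) S (new h) S′ → Agree h i S′
  coincide-agree h i j a ψ S S′ (_ , from) v′ v′∈ with from v′ v′∈
  ... | v , _ , eq = extend-agreeʳ (P i) (P⁺ (upper h)) (move j a (ψ v)) (base h (ι v′)) eq

  agree-unique : ∀ h i i′ S → ∣ S ∣ ≡ s → Agree h i S → Agree h i′ S → i ≡ i′
  agree-unique h i i′ S ∣S∣ ag ag′ with enumerate S ∣S∣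
  ... | x , x-inj , x∈ = P-unique i i′ (λ a → point (base h (ι (x a))))
    (λ a b eq → x-inj a b (ι-inj _ _ (,-injectiveˡ (point-injective _ _ eq))))
    (λ a → trans (ag (x a) (x∈ a)) (sym (ag′ (x a) (x∈ a))))

  -- A vertex of `S′` outside `S`, added to the s vertices of `S`, would make a word of `P` and a
  -- word of `P⁺` agree in s + 1 points. So each word of `P` threatens at most one shadow set of
  -- `h`, and the conditions for different shadow sets concern different, independently moved copies
  -- of the old packing.
  agree-same : ∀ h i S S′ → ∣ S ∣ ≡ s → ∣ S′ ∣ ≡ s → Agree h i S → Agree h i S′ → S′ ≡ S
  agree-same h i S S′ ∣S∣ ∣S′∣ ag ag′ = ⊆∧∣≡∣⇒≡ sub (trans ∣S′∣ (sym ∣S∣))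
    where
    sub : S′ ⊆ S
    sub {v} v∈S′ with v ∈? S | enumerate S ∣S∣
    ... | yes v∈S | _ = v∈S
    ... | no  v∉S | x , x-inj , x∈ = contradiction agrees
          (P-P⁺ i _ (λ a → point (base h (ι (x⁺ a))))
            (λ a b eq → x⁺-inj a b (ι-inj _ _ (,-injectiveˡ (point-injective _ _ eq)))))
      where
      x⁺ : Fin (suc s) → Fin k
      x⁺ zero    = v
      x⁺ (suc a) = x a
      x⁺-inj : OneToOne x⁺
      x⁺-inj zero    zero    _  = refl
      x⁺-inj zero    (suc b) eq = contradiction (subst (_∈ S) (sym eq) (x∈ b)) v∉S
      x⁺-inj (suc a) zero    eq = contradiction (subst (_∈ S) eq (x∈ a)) v∉S
      x⁺-inj (suc a) (suc b) eq = cong suc (x-inj a b eq)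
      agrees : ∀ a → P i (point (base h (ι (x⁺ a)))) ≡ P⁺ _ (point (base h (ι (x⁺ a))))
      agrees zero    = ag′ v v∈S′
      agrees (suc a) = ag (x a) (x∈ a)

  _≟²_ : (x y : Fin n × Fin (c * q)) → Dec (x ≡ y)
  _≟²_ = ×-≡-dec _≟ᶠ_ _≟ᶠ_

  Ok : Fin L → Fin N → Fin E → Fin (c ^ n) → Set
  Ok h i j a = All (λ ψ → Disjoint F (old i j (finToFun a) ∘ ψ) (new h)) copies

  ok? : ∀ h i j a → Dec (Ok h i j a)
  ok? h i j a = All.all? (λ ψ → disjoint? _≟²_ F (old i j (finToFun a) ∘ ψ) (new h)) copies

  Constrained : Fin L → Fin N → Set
  Constrained h i = ∃[ j ] Agree h i (F-at j)

  constrained? : ∀ h i → Dec (Constrained h i)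
  constrained? h i = any? (λ j → agree? h i (F-at j))

  unconstrained-ok : ∀ h i → ¬ Constrained h i → ∀ j a → Ok h i j a
  unconstrained-ok h i free j a = All.tabulate λ {ψ} _ S S′ _ S′∈ co →
    free (index S′∈ , subst (Agree h i) (lookup-index S′∈) (coincide-agree h i j (finToFun a) ψ S S′ co))

  shift : Fin L → Fin E → (Fin n → Fin c) → Fin n → Fin c
  shift h j a u = reflect (a u) (word (lower h) (π j u))

  -- A conflict can only be over the j-th shadow set. Undoing the move turns it into an old copy
  -- that covers the pulled-back section `shift` over `T`.
  uncovered-ok : ∀ h i j a → Agree h i (F-at j) → ¬ Covered F copies (shift h j (finToFun a)) T → Ok h i j a
  uncovered-ok h i j a ag unc = All.tabulate λ {ψ} ψ∈ S S′ S∈ S′∈ co →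
    unc (Any.map (λ { refl → Any.map (λ { refl → fits ψ S S′ co
      (agree-same h i (F-at j) S′ (∣F-at∣ j) (∣F∣ S′ S′∈) ag (coincide-agree h i j (finToFun a) ψ S S′ co)) }) S∈ }) ψ∈)
    where
    fits : ∀ ψ S S′ → Coincide (old i j (finToFun a) ∘ ψ) S (new h) S′ → S′ ≡ F-at j → Fits ψ S (shift h j (finToFun a)) T
    fits ψ S S′ (to , _) refl v v∈ with to v v∈
    ... | v′ , v′∈ , eq with extend-cancel (P i) (P⁺ (upper h)) (move j (finToFun a) (ψ v)) (base h (ι v′)) eq
    ...   | eq₁ , _ = π-T j _ (subst (_∈ image ι (F-at j)) (sym (,-injectiveˡ eq₁)) (∈-image⁺ ι v′∈)) ,
      trans (sym (reflect-involutive (finToFun a (proj₁ (ψ v))) (proj₂ (ψ v))))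
        (cong (reflect (finToFun a (proj₁ (ψ v))))
          (trans (,-injectiveʳ eq₁) (cong (word _) (sym (,-injectiveˡ eq₁)))))

  shiftᶠ : Fin L → Fin E → Fin (c ^ n) → Fin (c ^ n)
  shiftᶠ h j a = funToFin (shift h j (finToFun a))

  finToFun-shiftᶠ : ∀ h j a → finToFun (shiftᶠ h j a) ≗ shift h j (finToFun a)
  finToFun-shiftᶠ h j a = finToFun-funToFin (shift h j (finToFun a))

  -- In each part the map sends x to - x - w for a fixed w. Being a bijection, it makes the
  -- pulled-back section uniform when `a` is uniform.
  shiftᶠ-involutive : ∀ h j a → shiftᶠ h j (shiftᶠ h j a) ≡ a
  shiftᶠ-involutive h j a = finToFun-injective λ u →
    trans (finToFun-shiftᶠ h j (shiftᶠ h j a) u)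
      (trans (reflect-comm _ w) (trans (cong (reflect w) (trans (finToFun-shiftᶠ h j a u) (reflect-comm _ w)))
        (reflect-involutive w _)))
    where
    w : ∀ {u} → Fin c
    w {u} = word (lower h) (π j u)

  covered-cong : ∀ {b b′ : Fin n → Fin c} → b ≗ b′ → Covered F copies b T → Covered F copies b′ T
  covered-cong eq = Any.map (Any.map λ fits v v∈ → proj₁ (fits v v∈) , trans (proj₂ (fits v v∈)) (eq _))

  -- The inverse probability of an acceptable move: `E` for drawing the right permutation, `K` for
  -- an uncovered section.
  K′ : ℕ
  K′ = E * K

  ok-count : Fin L → Fin N → ℕ
  ok-count h i = sum (λ j → sum (λ a → ind (ok? h i j a)))

  ok-dense : ∀ h i → E * c ^ n ≤ ok-count h i * K′ ^ ind (constrained? h i)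
  ok-dense h i = go (constrained? h i)
    where
    open ≤-Reasoning
    go : (d : Dec (Constrained h i)) → E * c ^ n ≤ ok-count h i * K′ ^ ind d
    go (no free) = ≤-reflexive (sym (trans (*-identityʳ _)
      (trans (sum-cong-≗ (λ j → trans (sum-cong-≗ (λ a → ind-yes (ok? h i j a) (unconstrained-ok h i free j a)))
                                      (trans (sum-const (c ^ n) 1) (*-identityʳ _))))
             (sum-const E (c ^ n)))))
    go (yes (j , ag)) = begin
      E * c ^ n                                          ≤⟨ *-monoʳ-≤ E dense ⟩
      E * (K * uncovered F copies T)
        ≡⟨ cong (λ z → E * (K * z)) (sym (sum-involution _ (shiftᶠ h j) (shiftᶠ-involutive h j))) ⟩
      E * (K * sum (λ a → ind (¬? (covered? F copies (finToFun (shiftᶠ h j a)) T))))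
        ≤⟨ *-monoʳ-≤ E (*-monoʳ-≤ K (sum-mono (λ a → ind-mono (¬? (covered? F copies (finToFun (shiftᶠ h j a)) T)) (ok? h i j a)
             (λ unc → uncovered-ok h i j a ag (unc ∘ covered-cong (sym ∘ finToFun-shiftᶠ h j a)))))) ⟩
      E * (K * sum (λ a → ind (ok? h i j a)))
        ≤⟨ *-monoʳ-≤ E (*-monoʳ-≤ K (term≤sum (λ j → sum (λ a → ind (ok? h i j a))) j)) ⟩
      E * (K * ok-count h i)                             ≡⟨ rearrange E K (ok-count h i) ⟩
      ok-count h i * (E * K * 1)                         ∎
      where
      rearrange : ∀ e k x → e * (k * x) ≡ x * (e * k * 1)
      rearrange = solve-∀

  -- Charge every constrained word to a shadow set of `h` that lies on it; no shadow set is charged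
  -- twice, as it lies on at most one word. This bounds the exponent of `K′` by `E`.
  constraints≤E : ∀ h → sum (λ i → ind (constrained? h i)) ≤ E
  constraints≤E h = begin
    sum (λ i → ind (constrained? h i))
      ≤⟨ sum-mono (λ i → go i (constrained? h i)) ⟩
    sum (λ i → sum (λ j → ind (agree? h i (F-at j))))
      ≡⟨ ∑-comm (λ i j → ind (agree? h i (F-at j))) ⟩
    sum (λ j → sum (λ i → ind (agree? h i (F-at j))))
      ≤⟨ sum-mono (λ j → sum-ind≤1 (λ i → agree? h i (F-at j)) (λ i i′ → agree-unique h i i′ (F-at j) (∣F-at∣ j))) ⟩
    sum {E} (λ _ → 1)
      ≡⟨ trans (sum-const E 1) (*-identityʳ E) ⟩
    E ∎
    where
    open ≤-Reasoning
    go : ∀ i (d : Dec (Constrained h i)) → ind d ≤ sum (λ j → ind (agree? h i (F-at j)))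
    go i (no _)         = z≤n
    go i (yes (j , ag)) = ≤-trans (≤-reflexive (sym (ind-yes (agree? h i (F-at j)) ag)))
                                  (term≤sum (λ j → ind (agree? h i (F-at j))) j)

  1≤c^n : 1 ≤ c ^ n
  1≤c^n = m^n>0 c {{>-nonZero 1≤c}} n

  -- ρ and τ choose how the copy of the old packing over each word of P is moved.
  module Chosen (ρ : Fin N → Fin E) (τ : Fin N → Fin (c ^ n)) where

    Passes : Fin L → Set
    Passes h = ∀ i → Ok h i (ρ i) (τ i)

    passes? : ∀ h → Dec (Passes h)
    passes? h = all? (λ i → ok? h i (ρ i) (τ i))

    old-copies : Fin N → List (Fin k → Fin n × Fin (c * q))
    old-copies i = map (λ ψ → old i (ρ i) (finToFun (τ i)) ∘ ψ) copies

    passing : List (Fin L)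
    passing = filter passes? (allFin L)

    old-disjoint : AllPairs (Disjoint F) (concat (List.tabulate old-copies))
    old-disjoint = AllPairsₚ.concat⁺
      (Allₚ.tabulate⁺ λ i → AllPairsₚ.map⁺ (AllPairs.map
        (λ {ψ} {ψ′} → Disjoint-∘ F (old i (ρ i) (finToFun (τ i))) (old-injective i (ρ i) (finToFun (τ i))) {ψ} {ψ′}) disjoint))
      (AllPairsₚ.tabulate⁺ λ i≢i′ → Allₚ.map⁺ (All.tabulate λ {ψ} ψ∈ → Allₚ.map⁺ (All.tabulate λ {ψ′} _ →
        apart i≢i′ ψ ψ′ (All.lookup transversal ψ∈))))
      where
      -- A shared s-set would force two words of `P` to agree in s points, which are distinct
      -- because `ψ` is one-to-one.
      apart : ∀ {i i′} → i ≢ i′ → ∀ ψ ψ′ → OneToOne (proj₁ ∘ ψ) →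
              Disjoint F (old i (ρ i) (finToFun (τ i)) ∘ ψ) (old i′ (ρ i′) (finToFun (τ i′)) ∘ ψ′)
      apart {i} {i′} i≢i′ ψ ψ′ ψ-inj S S′ S∈ _ (to , _) with enumerate S (∣F∣ S S∈)
      ... | x , x-inj , x∈ = i≢i′ (P-unique i i′ (λ a → point (move (ρ i) (finToFun (τ i)) (ψ (x a))))
              (λ a b eq → x-inj a b (ψ-inj _ _ (cong proj₁ (move-injective (ρ i) (finToFun (τ i)) _ _ (point-injective _ _ eq)))))
              agrees)
        where
        agrees : ∀ a → P i (point (move (ρ i) (finToFun (τ i)) (ψ (x a)))) ≡ P i′ (point (move (ρ i) (finToFun (τ i)) (ψ (x a))))
        agrees a with to (x a) (x∈ a)
        ... | v′ , _ , eq = extend-agree (P i) (P i′) (move (ρ i) (finToFun (τ i)) (ψ (x a)))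
              (move (ρ i′) (finToFun (τ i′)) (ψ′ v′)) eq

    new-disjoint : AllPairs (Disjoint F) (map new passing)
    new-disjoint = AllPairsₚ.map⁺ (AllPairsₚ.filter⁺ passes? (AllPairs.map (λ {h} {h′} → apart {h} {h′}) (Uniqueₚ.allFin⁺ L)))
      where
      apart : ∀ {h h′} → h ≢ h′ → Disjoint F (new h) (new h′)
      apart {h} {h′} h≢h′ S S′ S∈ _ (to , _) with enumerate S (∣F∣ S S∈)
      ... | x , x-inj , x∈ = h≢h′ (Code.unique code′ h h′ (ι ∘ x) (λ a b eq → x-inj a b (ι-inj _ _ eq)) agrees)
        where
        agrees : ∀ a → word′ h (ι (x a)) ≡ word′ h′ (ι (x a))
        agrees a with to (x a) (x∈ a)
        ... | v′ , _ , eq = trans (,-injectiveʳ eq) (cong (word′ h′) (sym (,-injectiveˡ eq)))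

    old-new-disjoint : All (λ φ → All (Disjoint F φ) (map new passing)) (concat (List.tabulate old-copies))
    old-new-disjoint = Allₚ.concat⁺ (Allₚ.tabulate⁺ λ i → Allₚ.map⁺ (All.tabulate λ {ψ} ψ∈ →
      Allₚ.map⁺ (All.tabulate λ {h} h∈ → All.lookup (proj₂ (∈-filter⁻ passes? {xs = allFin L} h∈) i) ψ∈)))

    packing : Packing F n (c * q)
    packing = record
      { copies      = concat (List.tabulate old-copies) ++ map new passing
      ; transversal = Allₚ.++⁺
          (Allₚ.concat⁺ (Allₚ.tabulate⁺ λ i → Allₚ.map⁺ (All.map (λ inj x y eq → inj x y (π-inj (ρ i) _ _ eq)) transversal)))
          (Allₚ.map⁺ (All.universal (λ _ → ι-inj) passing))
      ; disjoint    = AllPairsₚ.++⁺ old-disjoint new-disjoint old-new-disjoint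
      }

    length-packing : length (Packing.copies packing) ≡ N * length copies + sum (λ h → ind (passes? h))
    length-packing = trans (length-++ (concat (List.tabulate old-copies)))
      (cong₂ _+_ (length-concat-tabulate old-copies (λ i → length-map _ copies))
                 (trans (length-map new passing) (length-filter-tabulate passes? id)))

  -- Divided by K′ ^ E and (c q) ^ s, this says that the number of copies per c ^ s grows by at
  -- least K′ ^ (- E).
  increment : Σ (Packing F n (c * q)) λ Ψ′ →
              N * (K′ ^ E * length copies) + (c * q) ^ s ≤ K′ ^ E * length (Packing.copies Ψ′)
  increment with derandomise N K′ ok? (λ h i → ind (constrained? h i)) (λ _ → 1) 1≤E 1≤c^n ok-dense
  ... | ρ , τ , bound = packing , (begin
    N * (K′ ^ E * length copies) + (c * q) ^ s
      ≡⟨ cong (N * (K′ ^ E * length copies) +_) (trans (sym (Code.count code′)) (sym (trans (sum-const L 1) (*-identityʳ L)))) ⟩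
    N * (K′ ^ E * length copies) + sum {L} (λ _ → 1)
      ≤⟨ +-monoʳ-≤ _ bound ⟩
    N * (K′ ^ E * length copies) + sum (λ h → 1 * (ind (passes? h) * K′ ^ sum (λ i → ind (constrained? h i))))
      ≤⟨ +-monoʳ-≤ _ (sum-mono (λ h → ≤-trans (≤-reflexive (*-identityˡ _))
           (*-monoʳ-≤ (ind (passes? h)) (^-monoʳ-≤ K′ {{>-nonZero 1≤K′}} (constraints≤E h))))) ⟩
    N * (K′ ^ E * length copies) + sum (λ h → ind (passes? h) * K′ ^ E)
      ≡⟨ cong (N * (K′ ^ E * length copies) +_) (sym (*-distribʳ-sum (K′ ^ E) (λ h → ind (passes? h)))) ⟩
    N * (K′ ^ E * length copies) + sum (λ h → ind (passes? h)) * K′ ^ E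
      ≡⟨ collect N (K′ ^ E) (length copies) _ ⟩
    K′ ^ E * (N * length copies + sum (λ h → ind (passes? h)))
      ≡⟨ cong (K′ ^ E *_) (sym length-packing) ⟩
    K′ ^ E * length (Packing.copies packing) ∎)
    where
    open ≤-Reasoning
    open Chosen ρ τ
    1≤K′ : 1 ≤ K′
    1≤K′ = *-mono-≤ 1≤E 1≤K
    collect : ∀ a b c d → a * (b * c) + d * b ≡ b * (a * c + d)
    collect = solve-∀

-- Double counting of covered transversals

lookup-injective : {A : Set} {xs : List A} → Unique xs → ∀ i j → lookup xs i ≡ lookup xs j → i ≡ j
lookup-injective (_ ∷ _) zero    zero    _  = refl
lookup-injective (a ∷ _) zero    (suc j) eq = contradiction eq (All.lookup a (∈-lookup j))
lookup-injective (a ∷ _) (suc i) zero    eq = contradiction (sym eq) (All.lookup a (∈-lookup i))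
lookup-injective (_ ∷ u) (suc i) (suc j) eq = cong suc (lookup-injective u i j eq)

ind-any≤ : {A : Set} {P : A → Set} (P? : Decidable P) (xs : List A) →
           ind (Any.any? P? xs) ≤ sum (λ i → ind (P? (lookup xs i)))
ind-any≤ P? [] = z≤n
ind-any≤ P? (x ∷ xs) with P? x
... | yes _ = s≤s z≤n
... | no _  = ind-any≤ P? xs

ind-¬ : {P : Set} (d : Dec P) → ind (¬? d) + ind d ≡ 1
ind-¬ (yes _) = refl
ind-¬ (no _)  = refl

sum-++ : ∀ m (f : Fin (m + n) → ℕ) → sum f ≡ sum (λ i → f (i ↑ˡ n)) + sum (λ j → f (m ↑ʳ j))
sum-++ zero    f = refl
sum-++ (suc m) f = trans (cong (f zero +_) (sum-++ m (f ∘ suc))) (sym (+-assoc (f zero) _ _))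

sum-combine : ∀ m n (f : Fin (m * n) → ℕ) → sum f ≡ sum (λ i → sum (λ j → f (combine {m} {n} i j)))
sum-combine zero    n f = refl
sum-combine (suc m) n f = trans (sum-++ n f) (cong (sum (λ j → f (j ↑ˡ (m * n))) +_) (sum-combine m n (λ i → f (n ↑ʳ i))))

finToFun-combine-zero : ∀ (y : Fin c) (b : Fin (c ^ n)) → finToFun {c} {suc n} (combine {c} {c ^ n} y b) zero ≡ y
finToFun-combine-zero {c} {n} y b = cong proj₁ (remQuot-combine {c} {c ^ n} y b)

finToFun-combine-suc : ∀ (y : Fin c) (b : Fin (c ^ n)) u → finToFun {c} {suc n} (combine {c} {c ^ n} y b) (suc u) ≡ finToFun b u
finToFun-combine-suc {c} {n} y b u = cong (λ z → finToFun (proj₂ z) u) (remQuot-combine {c} {c ^ n} y b)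

-- At most c ^ (n - |T|) sections have prescribed values on `T`; the power is moved to the left to
-- avoid subtraction. The recursion splits off the value at `zero`, the leading digit of `b`.
prescribed-count : ∀ n (T : Subset n) (y : Fin n → Fin c) {P : Fin (c ^ n) → Set} (P? : ∀ b → Dec (P b)) →
                   (∀ b → P b → ∀ u → u ∈ T → finToFun b u ≡ y u) →
                   c ^ ∣ T ∣ * sum (λ b → ind (P? b)) ≤ c ^ n
prescribed-count zero [] y P? h = begin
  1 * sum (λ b → ind (P? b)) ≡⟨ *-identityˡ _ ⟩
  sum (λ b → ind (P? b))     ≤⟨ +-monoˡ-≤ 0 (ind≤1 (P? zero)) ⟩
  1                          ∎
  where open ≤-Reasoning
prescribed-count {c} (suc n) (outside ∷ T) y P? h = begin
  c ^ ∣ T ∣ * sum (λ b → ind (P? b))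
    ≡⟨ cong (c ^ ∣ T ∣ *_) (sum-combine c (c ^ n) (λ b → ind (P? b))) ⟩
  c ^ ∣ T ∣ * sum (λ x → sum (λ b → ind (P? (combine {c} {c ^ n} x b))))
    ≡⟨ *-distribˡ-sum (c ^ ∣ T ∣) (λ x → sum (λ b → ind (P? (combine {c} {c ^ n} x b)))) ⟩
  sum (λ x → c ^ ∣ T ∣ * sum (λ b → ind (P? (combine {c} {c ^ n} x b))))
    ≤⟨ sum-mono (λ x → prescribed-count n T (y ∘ suc) (λ b → P? (combine {c} {c ^ n} x b))
         (λ b p u u∈ → trans (sym (finToFun-combine-suc x b u)) (h (combine {c} {c ^ n} x b) p (suc u) (there u∈)))) ⟩
  sum {c} (λ x → c ^ n)
    ≡⟨ sum-const c (c ^ n) ⟩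
  c ^ suc n ∎
  where open ≤-Reasoning
prescribed-count {c} (suc n) (inside ∷ T) y P? h = begin
  c * c ^ ∣ T ∣ * sum (λ b → ind (P? b))
    ≡⟨ cong (c * c ^ ∣ T ∣ *_) (sum-combine c (c ^ n) (λ b → ind (P? b))) ⟩
  c * c ^ ∣ T ∣ * sum (λ x → sum (λ b → ind (P? (combine {c} {c ^ n} x b))))
    ≡⟨ *-assoc c (c ^ ∣ T ∣) _ ⟩
  c * (c ^ ∣ T ∣ * sum (λ x → sum (λ b → ind (P? (combine {c} {c ^ n} x b)))))
    ≡⟨ cong (c *_) (*-distribˡ-sum (c ^ ∣ T ∣) (λ x → sum (λ b → ind (P? (combine {c} {c ^ n} x b))))) ⟩
  c * sum (λ x → c ^ ∣ T ∣ * sum (λ b → ind (P? (combine {c} {c ^ n} x b))))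
    ≤⟨ *-monoʳ-≤ c (sum-mono (λ x → slice x (x ≟ᶠ y zero))) ⟩
  c * sum {c} (λ x → ind (x ≟ᶠ y zero) * c ^ n)
    ≡⟨ cong (c *_) (sym (*-distribʳ-sum (c ^ n) (λ x → ind (x ≟ᶠ y zero)))) ⟩
  c * (sum {c} (λ x → ind (x ≟ᶠ y zero)) * c ^ n)
    ≤⟨ *-monoʳ-≤ c (*-monoˡ-≤ (c ^ n) (sum-ind≤1 (_≟ᶠ y zero) (λ _ _ p q → trans p (sym q)))) ⟩
  c * (1 * c ^ n)
    ≡⟨ cong (c *_) (*-identityˡ (c ^ n)) ⟩
  c ^ suc n ∎
  where
  open ≤-Reasoning
  slice : ∀ x (d : Dec (x ≡ y zero)) → c ^ ∣ T ∣ * sum (λ b → ind (P? (combine {c} {c ^ n} x b))) ≤ ind d * c ^ n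
  slice x (yes _) = ≤-trans (prescribed-count n T (y ∘ suc) (λ b → P? (combine {c} {c ^ n} x b))
      (λ b p u u∈ → trans (sym (finToFun-combine-suc x b u)) (h (combine {c} {c ^ n} x b) p (suc u) (there u∈))))
    (≤-reflexive (sym (*-identityˡ (c ^ n))))
  slice x (no x≢) = ≤-reflexive (trans (cong (c ^ ∣ T ∣ *_)
      (trans (sum-cong-≗ (λ b → ind-no (P? (combine {c} {c ^ n} x b)) (λ p →
        x≢ (trans (sym (finToFun-combine-zero {c} {n} x b)) (h (combine {c} {c ^ n} x b) p zero here)))))
             (trans (sum-const (c ^ n) 0) (*-zeroʳ (c ^ n)))))
    (*-zeroʳ (c ^ ∣ T ∣)))

_≟ˢ_ : (p q : Subset n) → Dec (p ≡ q)
_≟ˢ_ = ≡-dec _≟ᵇ_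

-- One shadow set of one copy covers only over the type it projects to. There any fitting section
-- `b₀` determines all the others on `T`, so it may serve as the prescription.
fits-count : (ψ : Fin k → Fin n × Fin c) → OneToOne (proj₁ ∘ ψ) → (S : Subset k) → ∣ S ∣ ≡ s →
             (T : Subset n) → ∣ T ∣ ≡ s →
             c ^ s * sum {c ^ n} (λ b → ind (fits? ψ S (finToFun b) T)) ≤ ind (T ≟ˢ image (proj₁ ∘ ψ) S) * c ^ n
fits-count {n = n} {c} {s} ψ inj S ∣S∣ T refl = go (T ≟ˢ T₀) (any? fits)
  where
  T₀ : Subset n
  T₀ = image (proj₁ ∘ ψ) S

  fits : ∀ b → Dec (Fits ψ S (finToFun {c} {n} b) T)
  fits b = fits? ψ S (finToFun b) T

  fits-≡ : ∀ b → Fits ψ S (finToFun {c} {n} b) T → T₀ ≡ T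
  fits-≡ b fit = ⊆∧∣≡∣⇒≡ sub (trans (∣image∣ _ (injection inj) S) ∣S∣)
    where
    sub : T₀ ⊆ T
    sub u∈ with ∈-image⁻ (proj₁ ∘ ψ) S u∈
    ... | v , v∈ , refl = proj₁ (fit v v∈)

  none : (∀ b → ¬ Fits ψ S (finToFun {c} {n} b) T) → c ^ ∣ T ∣ * sum (λ b → ind (fits b)) ≡ 0
  none unfit = trans (cong (c ^ ∣ T ∣ *_) (trans (sum-cong-≗ (λ b → ind-no (fits b) (unfit b)))
    (trans (sum-const (c ^ n) 0) (*-zeroʳ (c ^ n))))) (*-zeroʳ (c ^ ∣ T ∣))

  fits-agree : T ≡ T₀ → ∀ b b′ → Fits ψ S (finToFun {c} {n} b) T → Fits ψ S (finToFun {c} {n} b′) T →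
               ∀ u → u ∈ T → finToFun b u ≡ finToFun b′ u
  fits-agree eq b b′ fit fit′ u u∈ with ∈-image⁻ (proj₁ ∘ ψ) S (subst (u ∈_) eq u∈)
  ... | v , v∈ , refl = trans (sym (proj₂ (fit v v∈))) (proj₂ (fit′ v v∈))

  go : (d : Dec (T ≡ T₀)) → Dec (∃[ b ] Fits ψ S (finToFun {c} {n} b) T) →
       c ^ ∣ T ∣ * sum (λ b → ind (fits b)) ≤ ind d * c ^ n
  go (no T≢)  _ = ≤-trans (≤-reflexive (none (λ b fit → T≢ (sym (fits-≡ b fit))))) z≤n
  go (yes eq) (no ¬fit) = ≤-trans (≤-reflexive (none (λ b fit → ¬fit (b , fit)))) z≤n
  go (yes eq) (yes (b₀ , fit₀)) = ≤-trans
    (prescribed-count n T (finToFun b₀) fits (λ b fit → fits-agree eq b b₀ fit fit₀))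
    (≤-reflexive (sym (*-identityˡ (c ^ n))))

module Density (F : List (Subset k)) (∣F∣ : ∀ S → S ∈ₗ F → ∣ S ∣ ≡ s) (Ψ : Packing F n c) (1≤c : 1 ≤ c) where

  open Packing Ψ

  types : List (Subset n)
  types = subsets n s

  M : ℕ
  M = length types

  types-unique : Unique types
  types-unique = Uniqueₚ.filter⁺ (λ p → ∣ p ∣ ≟ s) (allSubsets-unique n)

  ∣type∣ : ∀ t → ∣ lookup types t ∣ ≡ s
  ∣type∣ t = proj₂ (∈-filter⁻ (λ p → ∣ p ∣ ≟ s) {xs = allSubsets n} (∈-lookup t))

  covered : Fin M → ℕ
  covered t = sum {c ^ n} (λ b → ind (covered? F copies (finToFun b) (lookup types t)))

  fit : Fin (length copies) → Fin (length F) → Fin M → ℕ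
  fit i j t = sum {c ^ n} (λ b → ind (fits? (lookup copies i) (lookup F j) (finToFun b) (lookup types t)))

  covered≤ : ∀ t → covered t ≤ sum (λ i → sum (λ j → fit i j t))
  covered≤ t = begin
    covered t
      ≤⟨ sum-mono (λ b → ≤-trans (ind-any≤ (λ ψ → Any.any? (λ S → fits? ψ S (finToFun b) (lookup types t)) F) copies)
           (sum-mono (λ i → ind-any≤ (λ S → fits? (lookup copies i) S (finToFun b) (lookup types t)) F))) ⟩
    sum {c ^ n} (λ b → sum (λ i → sum (λ j → f b i j)))
      ≡⟨ ∑-comm (λ b i → sum (λ j → f b i j)) ⟩
    sum (λ i → sum {c ^ n} (λ b → sum (λ j → f b i j)))
      ≡⟨ sum-cong-≗ (λ i → ∑-comm (λ b j → f b i j)) ⟩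
    sum (λ i → sum (λ j → fit i j t)) ∎
    where
    open ≤-Reasoning
    f : Fin (c ^ n) → Fin (length copies) → Fin (length F) → ℕ
    f b i j = ind (fits? (lookup copies i) (lookup F j) (finToFun b) (lookup types t))

  fit-total : ∀ i j → c ^ s * sum (fit i j) ≤ c ^ n
  fit-total i j = begin
    c ^ s * sum (fit i j)              ≡⟨ *-distribˡ-sum (c ^ s) (fit i j) ⟩
    sum (λ t → c ^ s * fit i j t)      ≤⟨ sum-mono (λ t → fits-count (lookup copies i) (All.lookup transversal (∈-lookup i))
                                            (lookup F j) (∣F∣ _ (∈-lookup j)) (lookup types t) (∣type∣ t)) ⟩
    sum (λ t → ind (lookup types t ≟ˢ T₀) * c ^ n)
      ≡⟨ sym (*-distribʳ-sum (c ^ n) (λ t → ind (lookup types t ≟ˢ T₀))) ⟩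
    sum (λ t → ind (lookup types t ≟ˢ T₀)) * c ^ n
      ≤⟨ *-monoˡ-≤ (c ^ n) (sum-ind≤1 (λ t → lookup types t ≟ˢ T₀)
           (λ t t′ p q → lookup-injective types-unique t t′ (trans p (sym q)))) ⟩
    1 * c ^ n                          ≡⟨ *-identityˡ (c ^ n) ⟩
    c ^ n ∎
    where
    open ≤-Reasoning
    T₀ : Subset n
    T₀ = image (proj₁ ∘ lookup copies i) (lookup F j)

  covered-total : c ^ s * sum covered ≤ length copies * (length F * c ^ n)
  covered-total = begin
    c ^ s * sum covered
      ≤⟨ *-monoʳ-≤ (c ^ s) (sum-mono covered≤) ⟩
    c ^ s * sum (λ t → sum (λ i → sum (λ j → fit i j t)))
      ≡⟨ cong (c ^ s *_) (trans (∑-comm (λ t i → sum (λ j → fit i j t))) (sum-cong-≗ (λ i → ∑-comm (λ t j → fit i j t)))) ⟩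
    c ^ s * sum (λ i → sum (λ j → sum (fit i j)))
      ≡⟨ *-distribˡ-sum (c ^ s) (λ i → sum (λ j → sum (fit i j))) ⟩
    sum (λ i → c ^ s * sum (λ j → sum (fit i j)))
      ≡⟨ sum-cong-≗ (λ i → *-distribˡ-sum (c ^ s) (λ j → sum (fit i j))) ⟩
    sum (λ i → sum (λ j → c ^ s * sum (fit i j)))
      ≤⟨ sum-mono (λ i → sum-mono (λ j → fit-total i j)) ⟩
    sum {length copies} (λ i → sum {length F} (λ j → c ^ n))
      ≡⟨ trans (sum-cong-≗ {length copies} (λ _ → sum-const (length F) (c ^ n))) (sum-const (length copies) _) ⟩
    length copies * (length F * c ^ n) ∎
    where open ≤-Reasoning

  complement : ∀ t → uncovered F copies (lookup types t) + covered t ≡ c ^ n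
  complement t = trans (sym (∑-distrib-+ {c ^ n} (λ b → ind (¬? (covered? F copies (finToFun b) (lookup types t))))
      (λ b → ind (covered? F copies (finToFun b) (lookup types t)))))
    (trans (sum-cong-≗ (λ b → ind-¬ (covered? F copies (finToFun b) (lookup types t))))
      (trans (sum-const (c ^ n) 1) (*-identityʳ (c ^ n))))

  -- The hypothesis bounds the covered fraction, averaged over all types, by K/(K + 1). Some type is
  -- therefore uncovered in at least a fraction 1/(K + 1).
  dense-type : ∀ K → 1 ≤ M → suc K * (length copies * length F) ≤ K * (M * c ^ s) →
               ∃[ T ] (∣ T ∣ ≡ s × c ^ n ≤ suc K * uncovered F copies T)
  dense-type K 1≤M sparse = choose (average {f = λ _ → c ^ n} {g = λ t → suc K * uncovered F copies (lookup types t)} 1≤M total)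
    where
    open ≤-Reasoning
    cov : suc K * sum covered ≤ K * (M * c ^ n)
    cov = *-cancelˡ-≤ (c ^ s) {{m^n≢0 c s {{>-nonZero 1≤c}}}} (begin
      c ^ s * (suc K * sum covered)                   ≡⟨ r₁ (c ^ s) (suc K) (sum covered) ⟩
      suc K * (c ^ s * sum covered)                   ≤⟨ *-monoʳ-≤ (suc K) covered-total ⟩
      suc K * (length copies * (length F * c ^ n))    ≡⟨ r₂ (suc K) (length copies) (length F) (c ^ n) ⟩
      suc K * (length copies * length F) * c ^ n      ≤⟨ *-monoˡ-≤ (c ^ n) sparse ⟩
      K * (M * c ^ s) * c ^ n                         ≡⟨ r₃ K M (c ^ s) (c ^ n) ⟩
      c ^ s * (K * (M * c ^ n))                       ∎)
      where
      r₁ : ∀ a b c → a * (b * c) ≡ b * (a * c)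
      r₁ = solve-∀
      r₂ : ∀ a b c d → a * (b * (c * d)) ≡ a * (b * c) * d
      r₂ = solve-∀
      r₃ : ∀ a b c d → a * (b * c) * d ≡ c * (a * (b * d))
      r₃ = solve-∀
    U = sum (λ t → uncovered F copies (lookup types t))
    U+V : U + sum covered ≡ M * c ^ n
    U+V = trans (sym (∑-distrib-+ (λ t → uncovered F copies (lookup types t)) covered))
                (trans (sum-cong-≗ complement) (sum-const M (c ^ n)))
    total : sum {M} (λ _ → c ^ n) ≤ sum (λ t → suc K * uncovered F copies (lookup types t))
    total = +-cancelʳ-≤ (K * (M * c ^ n)) _ _ (begin
      sum {M} (λ _ → c ^ n) + K * (M * c ^ n)         ≡⟨ cong (_+ K * (M * c ^ n)) (sum-const M (c ^ n)) ⟩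
      suc K * (M * c ^ n)                             ≡⟨ cong (suc K *_) (sym U+V) ⟩
      suc K * (U + sum covered)                       ≡⟨ *-distribˡ-+ (suc K) U _ ⟩
      suc K * U + suc K * sum covered                 ≤⟨ +-monoʳ-≤ (suc K * U) cov ⟩
      suc K * U + K * (M * c ^ n)
        ≡⟨ cong (_+ K * (M * c ^ n)) (*-distribˡ-sum (suc K) (λ t → uncovered F copies (lookup types t))) ⟩
      sum (λ t → suc K * uncovered F copies (lookup types t)) + K * (M * c ^ n) ∎)
    choose : (∃[ t ] c ^ n ≤ suc K * uncovered F copies (lookup types t)) →
             ∃[ T ] (∣ T ∣ ≡ s × c ^ n ≤ suc K * uncovered F copies T)
    choose (t , le) = lookup types t , ∣type∣ t , le

-- Iterating the increment

module Saturation (F : List (Subset k)) (∣F∣ : ∀ S → S ∈ₗ F → ∣ S ∣ ≡ s) (1≤E : 1 ≤ length F)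
                  (ι : Fin k → Fin n) (ι-inj : OneToOne ι) (1≤nCs : 1 ≤ n C s) (K : ℕ)
                  (sparse : ∀ c → 1 ≤ c → (Ψ : Packing F n c) →
                            suc K * (length (Packing.copies Ψ) * length F) ≤ K * ((n C s) * c ^ s)) where

  E K′ : ℕ
  E  = length F
  K′ = E * suc K

  Gain : ∀ c → Packing F n c → Set
  Gain c Ψ = ∃[ q ] (1 ≤ q × Code s n (c * q) × Σ (Packing F n (c * q)) λ Ψ′ →
    q ^ s * (K′ ^ E * length (Packing.copies Ψ)) + (c * q) ^ s ≤ K′ ^ E * length (Packing.copies Ψ′))

  gain : ∀ c → 1 ≤ c → (Ψ : Packing F n c) → Code s n c →
         ∃[ T ] (∣ T ∣ ≡ s × c ^ n ≤ suc K * uncovered F (Packing.copies Ψ) T) → Gain c Ψ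
  gain c 1≤c Ψ W (T , ∣T∣ , dense) = q , s≤s z≤n , I.code′ , I.increment
    where
    -- The polynomials are evaluated at the n c points of the current packing, so the modulus grows
    -- from step to step.
    open Polynomial s (n * c)
    module I = Increment F ∣F∣ ι ι-inj 1≤c Ψ W {q}
      (poly ∘ finToFun) (poly⁺ ∘ finToFun)
      (λ i j x inj eq → finToFun-injective (poly-unique (finToFun i) (finToFun j) x (injection inj) eq))
      (λ i j x inj eq → finToFun-injective (poly⁺-unique (finToFun i) (finToFun j) x (injection inj) eq))
      (λ i j x inj → poly-poly⁺ (finToFun i) (finToFun j) x (injection inj))
      T ∣T∣ (suc K) (s≤s z≤n) dense 1≤E

  -- There are at least j / K′ ^ E copies per c ^ s. The code is part of the invariant because the
  -- next increment builds its new copies on it.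
  Reached : ℕ → Set
  Reached j = ∃[ c ] (1 ≤ c × Code s n c × Σ (Packing F n c) λ Ψ → j * c ^ s ≤ K′ ^ E * length (Packing.copies Ψ))

  start : Reached 0
  start = 1 , s≤s z≤n , trivial , record { copies = [] ; transversal = [] ; disjoint = [] } , z≤n
    where
    trivial : Code s n 1
    trivial = record { size = 1 ; word = λ _ _ → zero ; count = sym (^-zeroˡ s) ; unique = λ { zero zero _ _ _ → refl } }

  extend-by : ∀ j c (Ψ : Packing F n c) → 1 ≤ c → j * c ^ s ≤ K′ ^ E * length (Packing.copies Ψ) → Gain c Ψ → Reached (suc j)
  extend-by j c Ψ 1≤c bound (q , 1≤q , C′ , Ψ′ , more) = c * q , *-mono-≤ 1≤c 1≤q , C′ , Ψ′ , (begin
    suc j * (c * q) ^ s                                              ≡⟨ cong (λ z → (c * q) ^ s + j * z) (^-distribʳ-* c q s) ⟩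
    (c * q) ^ s + j * (c ^ s * q ^ s)                                ≡⟨ rearrange ((c * q) ^ s) j (c ^ s) (q ^ s) ⟩
    q ^ s * (j * c ^ s) + (c * q) ^ s                                ≤⟨ +-monoˡ-≤ _ (*-monoʳ-≤ (q ^ s) bound) ⟩
    q ^ s * (K′ ^ E * length (Packing.copies Ψ)) + (c * q) ^ s       ≤⟨ more ⟩
    K′ ^ E * length (Packing.copies Ψ′)                              ∎)
    where
    open ≤-Reasoning
    rearrange : ∀ a b c d → a + b * (c * d) ≡ d * (b * c) + a
    rearrange = solve-∀

  reach-suc : ∀ j → Reached j → Reached (suc j)
  reach-suc j (c , 1≤c , W , Ψ , bound) = extend-by j c Ψ 1≤c bound (gain c 1≤c Ψ W
    (Density.dense-type F ∣F∣ Ψ 1≤c K (subst (1 ≤_) (sym (length-subsets n s)) 1≤nCs)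
      (subst (λ z → suc K * (length (Packing.copies Ψ) * E) ≤ K * (z * c ^ s)) (sym (length-subsets n s)) (sparse c 1≤c Ψ))))

  reach : ∀ j → Reached j
  reach zero    = start
  reach (suc j) = reach-suc j (reach j)

  -- `sparse` also caps the number of copies: dropping the factors `suc K` and `E` on its left
  -- leaves at most K (n C s) copies per c ^ s, and the target exceeds this by one unit of 1 / K′ ^
  -- E.
  unreachable : ¬ Reached (suc (K′ ^ E * (K * (n C s))))
  unreachable (c , 1≤c , _ , Ψ , bound) = <⇒≱ (m<m+n (K′ ^ E * (K * (n C s)) * c ^ s) (m^n>0 c {{>-nonZero 1≤c}} s)) (begin
    K′ ^ E * (K * (n C s)) * c ^ s + c ^ s       ≡⟨ +-comm (K′ ^ E * (K * (n C s)) * c ^ s) (c ^ s) ⟩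
    suc (K′ ^ E * (K * (n C s))) * c ^ s         ≤⟨ bound ⟩
    K′ ^ E * μ                                   ≤⟨ *-monoʳ-≤ (K′ ^ E) (begin
      μ               ≤⟨ m≤m*n μ E {{>-nonZero 1≤E}} ⟩
      μ * E           ≤⟨ m≤m+n _ _ ⟩
      suc K * (μ * E) ≤⟨ sparse c 1≤c Ψ ⟩
      K * ((n C s) * c ^ s) ∎) ⟩
    K′ ^ E * (K * ((n C s) * c ^ s))             ≡⟨ rearrange (K′ ^ E) K (n C s) (c ^ s) ⟩
    K′ ^ E * (K * (n C s)) * c ^ s               ∎)
    where
    open ≤-Reasoning
    μ = length (Packing.copies Ψ)
    rearrange : ∀ a b c d → a * (b * (c * d)) ≡ a * (b * c) * d
    rearrange = solve-∀

  absurd : ⊥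
  absurd = unreachable (reach (suc (K′ ^ E * (K * (n C s)))))

-- Binomial estimates and the equivalence

C-absorb : ∀ n s → suc s * (n C suc s) + s * (n C s) ≡ n * (n C s)
C-absorb zero    zero    = refl
C-absorb zero    (suc s) = cong₂ _+_ (*-zeroʳ (2+ s)) (*-zeroʳ (suc s))
C-absorb (suc n) zero    = begin
  1 * (suc n C 1) + 0 ≡⟨ +-identityʳ _ ⟩
  1 * (suc n C 1)     ≡⟨ *-identityˡ _ ⟩
  suc n C 1           ≡⟨ nC1≡n (suc n) ⟩
  suc n               ≡⟨ sym (*-identityʳ (suc n)) ⟩
  suc n * 1           ∎
  where open ≡-Reasoning
C-absorb (suc n) (suc s) = begin
  suc (suc s) * (suc n C suc (suc s)) + suc s * (suc n C suc s)
    ≡⟨ cong₂ (λ x y → suc (suc s) * x + suc s * y) (sym (nCk+nC[k+1]≡[n+1]C[k+1] n (suc s))) (sym (nCk+nC[k+1]≡[n+1]C[k+1] n s)) ⟩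
  suc (suc s) * (b + d) + suc s * (a + b)
    ≡⟨ regroup s a b d ⟩
  (suc (suc s) * d + suc s * b) + (suc s * b + s * a) + (a + b)
    ≡⟨ cong₂ (λ x y → x + y + (a + b)) (C-absorb n (suc s)) (C-absorb n s) ⟩
  n * b + n * a + (a + b)
    ≡⟨ collect n a b ⟩
  suc n * (a + b)
    ≡⟨ cong (suc n *_) (nCk+nC[k+1]≡[n+1]C[k+1] n s) ⟩
  suc n * (suc n C suc s) ∎
  where
  open ≡-Reasoning
  a = n C s
  b = n C suc s
  d = n C suc (suc s)
  regroup : ∀ s a b d → (2 + s) * (b + d) + (1 + s) * (a + b) ≡ ((2 + s) * d + (1 + s) * b) + ((1 + s) * b + s * a) + (a + b)
  regroup = solve-∀
  collect : ∀ n a b → n * b + n * a + (a + b) ≡ (1 + n) * (a + b)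
  collect = solve-∀

-- The falling factorial n (n - 1) ⋯ (n - s + 1), written without truncated subtraction.
falling : ℕ → ℕ → ℕ
falling n s = s ! * (n C s)

falling-suc : ∀ n s → falling n (suc s) + s * falling n s ≡ n * falling n s
falling-suc n s = begin
  suc s * s ! * (n C suc s) + s * (s ! * (n C s))    ≡⟨ r₁ (suc s) (s !) (n C suc s) s (n C s) ⟩
  s ! * (suc s * (n C suc s) + s * (n C s))          ≡⟨ cong (s ! *_) (C-absorb n s) ⟩
  s ! * (n * (n C s))                                ≡⟨ r₂ (s !) n (n C s) ⟩
  n * (s ! * (n C s)) ∎
  where
  open ≡-Reasoning
  r₁ : ∀ a b x s y → a * b * x + s * (b * y) ≡ b * (a * x + s * y)
  r₁ = solve-∀
  r₂ : ∀ a b c → a * (b * c) ≡ b * (a * c)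
  r₂ = solve-∀

falling≤^ : ∀ n s → falling n s ≤ n ^ s
falling≤^ n zero    = ≤-refl
falling≤^ n (suc s) = begin
  falling n (suc s)                      ≤⟨ m≤m+n _ _ ⟩
  falling n (suc s) + s * falling n s    ≡⟨ falling-suc n s ⟩
  n * falling n s                        ≤⟨ *-monoʳ-≤ n (falling≤^ n s) ⟩
  n ^ suc s                              ∎
  where open ≤-Reasoning

-- For positive n this reads falling n s ≥ (1 - s²/n) n ^ s. The step from s to s + 1 loses a
-- further s/n, and s² + s ≤ (s + 1)².
^≤falling : ∀ n s → n * n ^ s ≤ n * falling n s + s * s * n ^ s
^≤falling n zero    = ≤-reflexive (sym (+-identityʳ _))
^≤falling n (suc s) = begin
  n * (n * n ^ s)
    ≤⟨ *-monoʳ-≤ n (^≤falling n s) ⟩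
  n * (n * falling n s + s * s * n ^ s)
    ≡⟨ cong (λ z → n * (z + s * s * n ^ s)) (sym (falling-suc n s)) ⟩
  n * (falling n (suc s) + s * falling n s + s * s * n ^ s)
    ≤⟨ *-monoʳ-≤ n (+-monoˡ-≤ (s * s * n ^ s) (+-monoʳ-≤ (falling n (suc s)) (*-monoʳ-≤ s (falling≤^ n s)))) ⟩
  n * (falling n (suc s) + s * n ^ s + s * s * n ^ s)
    ≤⟨ m≤m+n _ (suc s * (n * n ^ s)) ⟩
  n * (falling n (suc s) + s * n ^ s + s * s * n ^ s) + suc s * (n * n ^ s)
    ≡⟨ collect n s (falling n (suc s)) (n ^ s) ⟩
  n * falling n (suc s) + suc s * suc s * (n * n ^ s) ∎
  where
  open ≤-Reasoning
  collect : ∀ n s a x → n * (a + s * x + s * s * x) + (1 + s) * (n * x) ≡ n * a + (1 + s) * (1 + s) * (n * x)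
  collect = solve-∀

-- All but a fraction 1/(D + 1) of the s-sets are transversal. The condition on n does not mention
-- c, so n can be fixed before any blow-up.
C-blowup : ∀ D n c s → 1 ≤ n → suc D * (s * s) ≤ n → D * ((n * c) C s) ≤ suc D * ((n C s) * c ^ s)
C-blowup D n c s 1≤n large = *-cancelˡ-≤ (s !) {{s !≢0}} (begin
  s ! * (D * ((n * c) C s))          ≡⟨ r₁ (s !) D ((n * c) C s) ⟩
  D * falling (n * c) s              ≤⟨ *-monoʳ-≤ D (falling≤^ (n * c) s) ⟩
  D * (n * c) ^ s                    ≡⟨ cong (D *_) (^-distribʳ-* n c s) ⟩
  D * (n ^ s * c ^ s)                ≡⟨ sym (*-assoc D (n ^ s) (c ^ s)) ⟩
  D * n ^ s * c ^ s                  ≤⟨ *-monoˡ-≤ (c ^ s) main ⟩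
  suc D * falling n s * c ^ s        ≡⟨ r₂ (suc D) (s !) (n C s) (c ^ s) ⟩
  s ! * (suc D * ((n C s) * c ^ s))  ∎)
  where
  open ≤-Reasoning
  r₁ : ∀ a b c → a * (b * c) ≡ b * (a * c)
  r₁ = solve-∀
  r₂ : ∀ a b c d → a * (b * c) * d ≡ b * (a * (c * d))
  r₂ = solve-∀
  r₃ : ∀ d n x → n * (d * x) + n * x ≡ (1 + d) * (n * x)
  r₃ = solve-∀
  r₄ : ∀ d n a t x → d * (n * a + t * x) ≡ n * (d * a) + d * t * x
  r₄ = solve-∀
  main : D * n ^ s ≤ suc D * falling n s
  main = *-cancelˡ-≤ n {{>-nonZero 1≤n}} (+-cancelʳ-≤ (n * n ^ s) _ _ (begin
    n * (D * n ^ s) + n * n ^ s                                 ≡⟨ r₃ D n (n ^ s) ⟩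
    suc D * (n * n ^ s)                                         ≤⟨ *-monoʳ-≤ (suc D) (^≤falling n s) ⟩
    suc D * (n * falling n s + s * s * n ^ s)                   ≡⟨ r₄ (suc D) n (falling n s) (s * s) (n ^ s) ⟩
    n * (suc D * falling n s) + suc D * (s * s) * n ^ s         ≤⟨ +-monoʳ-≤ (n * (suc D * falling n s)) (*-monoˡ-≤ (n ^ s) large) ⟩
    n * (suc D * falling n s) + n * n ^ s                       ∎))

1≤C : ∀ n s → s ≤ n → 1 ≤ n C s
1≤C n       zero    _         = ≤-refl
1≤C (suc n) (suc s) (s≤s s≤n) = ≤-trans (≤-trans (1≤C n s s≤n) (m≤m+n _ _)) (≤-reflexive (nCk+nC[k+1]≡[n+1]C[k+1] n s))

-- The two implications

Kalai : Set
Kalai = ∀ (r t : ℕ) → 2 ≤ r → 2 ≤ t →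
        ∀ (k : ℕ) (T : RGraph r k) → IsTightTree T → e T ≡ t →
        ∀ (n : ℕ) → r ≤ n →
        r * ex n T ≤ (t ∸ 1) * (n C (r ∸ 1))

ShadowKalai : Set
ShadowKalai = ∀ (r t : ℕ) → 2 ≤ r → 1 ≤ t →
              ∀ (k : ℕ) (T : RGraph r k) → IsTightTree T → e T ≡ t →
              ∀ (n : ℕ) (G : RGraph r n) → ¬ Contains G T →
              r * e G ≤ (t ∸ 1) * length (∂ G)

shadow⇒kalai : ShadowKalai → Kalai
shadow⇒kalai A r t 2≤r 2≤t k T tight eT n _
  with ((G , eG , avoid) , _) ← ex-largest n T (≤-trans (s≤s z≤n) (≤-trans 2≤t (≤-reflexive (sym eT))))
  = begin
    r * ex n T                  ≡⟨ cong (r *_) (sym eG) ⟩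
    r * e G                     ≤⟨ A r t 2≤r (≤-trans (s≤s z≤n) 2≤t) k T tight eT n G avoid ⟩
    (t ∸ 1) * length (∂ G)      ≤⟨ *-monoʳ-≤ (t ∸ 1) (∣∂∣≤ G) ⟩
    (t ∸ 1) * (n C (r ∸ 1))     ∎
  where open ≤-Reasoning

module _ (G : RGraph r k) (1≤r : 1 ≤ r) (T : RGraph r l) (tight : IsTightTree T) (1≤eT : 1 ≤ e T)
         (avoid : ¬ Contains G T) (Ψ : Packing (∂ G) n c) where

  open Packing Ψ

  flat : List (Fin k → Fin (n * c))
  flat = map (uncurry combine ∘_) copies

  module U = Union G 1≤r flat
    (Allₚ.map⁺ (All.map (λ inj x y eq → inj x y (cong proj₁ (combine-cancel eq))) transversal))
    (AllPairsₚ.map⁺ (AllPairs.map (λ {ψ} {ψ′} → Disjoint-∘ (∂ G) (uncurry combine) (λ _ _ → combine-cancel) {ψ} {ψ′}) disjoint))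

  -- Each packed copy of the shadow carries a copy of `G`, and their union on n c vertices competes
  -- in the definition of `ex`.
  packing-bound : length copies * e G ≤ ex (n * c) T
  packing-bound = ≤-trans
    (≤-reflexive (sym (trans U.e-union (cong (_* e G) (length-map _ copies)))))
    (proj₂ (ex-largest (n * c) T 1≤eT) (e U.union) (U.union , refl , U.union-avoids T tight 1≤eT avoid))

∂-size : (G : RGraph r k) → ∀ S → S ∈ₗ ∂ G → ∣ S ∣ ≡ r ∸ 1
∂-size G S S∈ = proj₁ (proj₂ (∈-filter⁻ _ {xs = allSubsets _} S∈))

∂-nonempty : (G : RGraph r k) → 1 ≤ r → 1 ≤ e G → 1 ≤ length (∂ G)
∂-nonempty {r} G 1≤r 1≤e = go (edges G) refl 1≤e
  where
  positive : ∀ {A : Set} {x : A} {xs} → x ∈ₗ xs → 1 ≤ length xs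
  positive (here _)  = s≤s z≤n
  positive (there _) = s≤s z≤n
  go : ∀ es → edges G ≡ es → 1 ≤ length es → 1 ≤ length (∂ G)
  go (d ∷ _) eq _ with d∈ ← subst (d ∈ₗ_) (sym eq) (here refl)
    with v , v∈ ← 0<∣p∣⇒Nonempty d (subst (1 ≤_) (sym (All.lookup (uniform G) d∈)) 1≤r)
    = positive (∈-∂ G {d - v} (cong (_∸ 1) (trans (∣p-x∣ v∈) (All.lookup (uniform G) d∈))) (p─q⊆p d ⁅ v ⁆) d∈)

kalai⇒shadow : Kalai → ShadowKalai
-- (B) starts at t = 2, so t = 1 is settled directly: a nonempty `G` contains a single edge.
kalai⇒shadow B r 1 2≤r _ k T tight eT n G avoid with e G in eG
... | zero  = ≤-reflexive (*-zeroʳ r)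
... | suc _ = contradiction (single-edge T tight eT G (subst (1 ≤_) (sym eG) (s≤s z≤n))) avoid
kalai⇒shadow B r t@(suc (suc t′)) 2≤r _ l T tight eT k G avoid =
  -- The inequality is decidable, so refuting its negation proves it constructively.
  decidable-stable (r * e G ≤? suc t′ * length (∂ G)) (λ ≰ → impossible (≰⇒> ≰))
  where
  open ≤-Reasoning
  σ E a D ν : ℕ
  σ = r ∸ 1
  E = length (∂ G)
  a = suc t′ * E
  -- If r e(G) ≥ a + 1, then (B) lets a packing cover at most a/(a + 1) = D/(D + 2) of all s-sets.
  -- Doubling makes room for D + 1 in between: half of the slack pays for the non-transversal
  -- s-sets, the other half stays uncovered.
  D = 2 * a
  -- The number of parts must admit an injection of the k vertices of `G`, reach r so that (B)
  -- applies, and be large enough for `C-blowup`.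
  ν = suc (k + r + suc D * (σ * σ))

  1≤r : 1 ≤ r
  1≤r = ≤-trans (s≤s z≤n) 2≤r

  1≤eT : 1 ≤ e T
  1≤eT = subst (1 ≤_) (sym eT) (s≤s z≤n)

  k≤ν : k ≤ ν
  k≤ν = m≤n⇒m≤1+n (≤-trans (m≤m+n k r) (m≤m+n (k + r) _))

  r≤ν : r ≤ ν
  r≤ν = m≤n⇒m≤1+n (≤-trans (m≤n+m r k) (m≤m+n (k + r) _))

  impossible : suc a ≤ r * e G → ⊥
  impossible dense = Saturation.absurd (∂ G) (∂-size G) (∂-nonempty G 1≤r 1≤eG)
      (λ v → inject≤ v k≤ν) (inject≤-injective k≤ν k≤ν) (1≤C ν σ (≤-trans (m∸n≤m r 1) r≤ν)) (suc D) sparse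
    where
    1≤eG : 1 ≤ e G
    1≤eG = n≢0⇒n>0 λ eG≡0 → contradiction dense (<⇒≱ (s≤s (≤-trans (≤-reflexive (trans (cong (r *_) eG≡0) (*-zeroʳ r))) z≤n)))

    sparse : ∀ c → 1 ≤ c → (Ψ : Packing (∂ G) ν c) →
             suc (suc D) * (length (Packing.copies Ψ) * E) ≤ suc D * ((ν C σ) * c ^ σ)
    sparse c 1≤c Ψ = begin
      suc (suc D) * (μ * E)                 ≡⟨ r₁ a μ E ⟩
      2 * (μ * suc a * E)                   ≤⟨ *-monoʳ-≤ 2 (*-monoˡ-≤ E (*-monoʳ-≤ μ dense)) ⟩
      2 * (μ * (r * e G) * E)               ≡⟨ cong (λ z → 2 * (z * E)) (r₂ μ r (e G)) ⟩
      2 * (r * (μ * e G) * E)               ≤⟨ *-monoʳ-≤ 2 (*-monoˡ-≤ E (*-monoʳ-≤ r (packing-bound G 1≤r T tight 1≤eT avoid Ψ))) ⟩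
      2 * (r * ex (ν * c) T * E)            ≤⟨ *-monoʳ-≤ 2 (*-monoˡ-≤ E (B r t 2≤r (s≤s (s≤s z≤n)) l T tight eT (ν * c)
                                                 (≤-trans r≤ν (m≤m*n ν c {{>-nonZero 1≤c}})))) ⟩
      2 * (suc t′ * ((ν * c) C σ) * E)      ≡⟨ r₃ (suc t′) ((ν * c) C σ) E ⟩
      D * ((ν * c) C σ)                     ≤⟨ C-blowup D ν c σ (s≤s z≤n) (m≤n⇒m≤1+n (m≤n+m _ (k + r))) ⟩
      suc D * ((ν C σ) * c ^ σ)             ∎
      where
      μ = length (Packing.copies Ψ)
      r₁ : ∀ a μ E → (2 + 2 * a) * (μ * E) ≡ 2 * (μ * (1 + a) * E)
      r₁ = solve-∀
      r₂ : ∀ a b c → a * (b * c) ≡ b * (a * c)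
      r₂ = solve-∀
      r₃ : ∀ t x E → 2 * (t * x * E) ≡ 2 * (t * E) * x
      r₃ = solve-∀

proposition2p2 : (∀ (r t : ℕ) → 2 ≤ r → 1 ≤ t →
    ∀ (k : ℕ) (T : RGraph r k) → IsTightTree T → e T ≡ t →
    ∀ (n : ℕ) (G : RGraph r n) → ¬ Contains G T →
    r * e G ≤ (t ∸ 1) * length (∂ G))
    ⇔
    (∀ (r t : ℕ) → 2 ≤ r → 2 ≤ t →
    ∀ (k : ℕ) (T : RGraph r k) → IsTightTree T → e T ≡ t →
    ∀ (n : ℕ) → r ≤ n →
    r * ex n T ≤ (t ∸ 1) * (n C (r ∸ 1)))
proposition2p2 = mk⇔ shadow⇒kalai kalai⇒shadow
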